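{- Let $\boldsymbol{\alpha}$ and $\boldsymbol{\beta}$ be integer compositions (finite sequences of positive integers) and suppose that $X_{P_{\boldsymbol{\alpha}}}=X_{P_{\boldsymbol{\beta}}}$. If one of the following conditions holds, then the signed paths $P_{\boldsymbol{\alpha}}$ and $P_{\boldsymbol{\beta}}$ are isomorphic: (1) the length of $\boldsymbol{\alpha}$ is less than or equal to $4$; (2) $\boldsymbol{\alpha}$ and $\boldsymbol{\beta}$ are both unimodal.
   Context: A signed graph is a quadruple $\Gamma=(V_\Gamma,E_\Gamma^+,E_\Gamma^-,L_\Gamma)$ where $V_\Gamma$ is a finite set (vertices), $E_\Gamma^+$ and $E_\Gamma^-$ are sets of 2-element subsets of $V_\Gamma$ (positive and negative edges), and $L_\Gamma\subseteq V_\Gamma$ (loops). Two signed graphs are isomorphic if there is a bijection of vertex sets carrying positive edges onto positive edges, negative edges onto negative edges, and loops onto loops. A map $\kappa:V_\Gamma\to\mathbb{Z}$ is a proper coloring if $\kappa(v)\ne\kappa(w)$ for $\{v,w\}\in E_\Gamma^+$, $\kappa(v)\neq-\kappa(w)$ for $\{v,w\}\in E_\Gamma^-$, and $\kappa(v)\ne0$ for $v\in L_\Gamma$. With indeterminates $(x_i)_{i\in\mathbb{Z}}$, the chromatic signed-symmetric function of $\Gamma$ is the formal power series $X_\Gamma=\sum_{\kappa}\prod_{v\in V_\Gamma}x_{\kappa(v)}$, the sum being over all proper colorings $\kappa:V_\Gamma\to\mathbb{Z}$. For a composition $\boldsymbol\alpha=(\alpha_1,\dots,\alpha_\ell)\in\mathbb{Z}_{>0}^\ell$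 of length $\ell\geq 1$, $P_{\boldsymbol\alpha}$ is the signed path (with no loops) obtained by taking paths $P_{\alpha_1},\dots,P_{\alpha_\ell}$ on $\alpha_1,\dots,\alpha_\ell$ vertices, all of whose edges are positive, and connecting them in this order into one path by negative edges (the last vertex of $P_{\alpha_i}$ is joined to the first vertex of $P_{\alpha_{i+1}}$ by a negative edge, for $1\le i<\ell$). The composition $\boldsymbol\alpha$ is unimodal if there is $t\in\{1,\dots,\ell\}$ with $\alpha_1\le\dots\le\alpha_t\ge\dots\ge\alpha_\ell$. -}

module Defs where

open import Data.Fin.Base using (Fin; inject₁; toℕ) renaming (suc to fsuc)
open import Data.Fin.Properties using (any?; all?; suc-injective)
  renaming (_≟_ to _≟ᶠ_)
open import Data.Fin.Subset as Subset using (Subset; _∈_)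
open import Data.Fin.Subset.Properties using (_∈?_)
open import Data.Integer.Base using (ℤ; 0ℤ; -_)
import Data.Integer.Properties as ℤ
open import Data.List.Base as List
  using (List; []; _∷_; _++_; replicate; take; drop; filter; deduplicate; cartesianProductWith)
open import Data.List.Membership.Propositional using () renaming (_∈_ to _∈ˡ_)
open import Data.List.Membership.DecPropositional ℤ._≟_ using () renaming (_∈?_ to _∈ˡ?_)
open import Data.List.Membership.Propositional.Properties
  using (∈-∃++; ∈-filter⁺; ∈-deduplicate⁺; ∈-cartesianProductWith⁺)
open import Data.List.NonEmpty.Base as List⁺ using (List⁺)
open import Data.List.NonEmpty.Relation.Unary.All as All⁺ using ()
open import Data.List.Relation.Binary.Permutation.Propositional
  using (_↭_; ↭-refl; ↭-sym; ↭-trans; prep)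
open import Data.List.Relation.Binary.Permutation.Propositional.Properties
  using (∈-resp-↭; shift; drop-mid; ¬x∷xs↭[])
open import Data.List.Relation.Unary.All using ([]; _∷_)
open import Data.List.Relation.Unary.AllPairs using ([]; _∷_)
open import Data.List.Relation.Unary.Any using (here; there)
open import Data.List.Relation.Unary.Linked using (Linked)
open import Data.List.Relation.Unary.Unique.Propositional using (Unique)
open import Data.List.Relation.Unary.Unique.Propositional.Properties
  using (filter⁺; cartesianProductWith⁺)
open import Data.List.Relation.Unary.Unique.DecPropositional.Properties ℤ._≟_
  using (deduplicate-!)
open import Data.Nat.Base using (ℕ; zero; suc; pred; _≤_; _≥_; NonZero)
open import Data.Product.Base using (∃-syntax; _×_; _,_)
open import Data.Sign.Base using (Sign) renaming (+ to pos; - to neg)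
import Data.Sign.Properties as Sign
open import Data.Sum.Base using (_⊎_; inj₁; inj₂)
open import Data.Vec.Base as Vec using (Vec; lookup)
open import Data.Vec.Properties using (∷-injective)
open import Function.Base using (_∘_)
open import Function.Bundles using (_↔_; _⇔_; Inverse)
open import Relation.Binary.Core using (Rel)
open import Relation.Binary.Definitions using (Decidable; Symmetric; Irreflexive)
open import Relation.Binary.PropositionalEquality using (_≡_; _≢_; refl; sym; trans)
open import Relation.Nullary.Decidable using (Dec; yes; no; ¬?; _×-dec_; _⊎-dec_; _→-dec_)
open import Level using (0ℓ)

------------------------------------------------------------------------
-- Signed graphs

-- A (decidable) set of 2-element subsets of Fin n: {u, w} belongs to the set
-- when Adj u w holds.
record EdgeSet (n : ℕ) : Set₁ where
  field
    Adj    : Rel (Fin n) 0ℓ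
    adj?   : Decidable Adj
    symm   : Symmetric Adj
    irrefl : Irreflexive _≡_ Adj

-- The positive and the negative edge set need not be disjoint.
record SignedGraph : Set₁ where
  field
    order : ℕ
    E⁺    : EdgeSet order
    E⁻    : EdgeSet order
    loops : Subset order

  open EdgeSet E⁺ public using ()
    renaming (Adj to Adj⁺; adj? to adj⁺?; symm to symm⁺; irrefl to irrefl⁺)
  open EdgeSet E⁻ public using ()
    renaming (Adj to Adj⁻; adj? to adj⁻?; symm to symm⁻; irrefl to irrefl⁻)

  Vertex : Set
  Vertex = Fin order

record _≅_ (Γ Δ : SignedGraph) : Set where
  private
    module Γ = SignedGraph Γ
    module Δ = SignedGraph Δ
  field
    bijection : Γ.Vertex ↔ Δ.Vertex
  open Inverse bijection public using (to)
  field
    positive : ∀ u w → Γ.Adj⁺ u w ⇔ Δ.Adj⁺ (to u) (to w)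
    negative : ∀ u w → Γ.Adj⁻ u w ⇔ Δ.Adj⁻ (to u) (to w)
    loop     : ∀ u → (u ∈ Γ.loops) ⇔ (to u ∈ Δ.loops)

------------------------------------------------------------------------
-- Proper colorings

-- The color of the vertex v under κ is lookup κ v.
Coloring : ℕ → Set
Coloring n = Vec ℤ n

module _ (Γ : SignedGraph) where
  open SignedGraph Γ

  Proper : Coloring order → Set
  Proper κ = (∀ v w → Adj⁺ v w → lookup κ v ≢ lookup κ w)
           × (∀ v w → Adj⁻ v w → lookup κ v ≢ - lookup κ w)
           × (∀ v → v ∈ loops → lookup κ v ≢ 0ℤ)

  proper? : (κ : Coloring order) → Dec (Proper κ)
  proper? κ =
          all? (λ v → all? λ w → adj⁺? v w →-dec ¬? (lookup κ v ℤ.≟ lookup κ w))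
    ×-dec all? (λ v → all? λ w → adj⁻? v w →-dec ¬? (lookup κ v ℤ.≟ - lookup κ w))
    ×-dec all? (λ v → (v ∈? loops) →-dec ¬? (lookup κ v ℤ.≟ 0ℤ))

------------------------------------------------------------------------
-- Formal power series in the indeterminates x i, i ∈ ℤ

-- The word i₁ ∷ … ∷ iₖ ∷ [] stands for the monomial x i₁ ⋯ x iₖ, so two words
-- stand for the same monomial exactly when they are permutations of each other.
Monomial : Set
Monomial = List ℤ

-- A power series is given by its coefficients.
PowerSeries : Set
PowerSeries = Monomial → ℕ

infix 4 _≐_
_≐_ : Rel PowerSeries 0ℓ
f ≐ g = ∀ m → f m ≡ g m

infix 4 _↭?_
_↭?_ : Decidable (_↭_ {A = ℤ})
[]       ↭? []       = yes ↭-refl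
[]       ↭? (y ∷ ys) = no (¬x∷xs↭[] ∘ ↭-sym)
(x ∷ xs) ↭? ys with x ∈ˡ? ys
... | no  x∉ys = no (λ p → x∉ys (∈-resp-↭ p (here refl)))
... | yes x∈ys with ∈-∃++ x∈ys
...   | as , bs , refl with xs ↭? (as ++ bs)
...     | yes p = yes (↭-trans (prep x p) (↭-sym (shift x as bs)))
...     | no ¬p = no (λ q → ¬p (drop-mid [] as q))

-- The product of x (κ v) over all vertices v.
monomial : ∀ {n} → Coloring n → Monomial
monomial = Vec.toList

-- All colorings with colors taken from the given list.
colorings : List ℤ → (n : ℕ) → List (Coloring n)
colorings cs zero    = Vec.[] ∷ []
colorings cs (suc n) = cartesianProductWith Vec._∷_ cs (colorings cs n)

-- A coloring with monomial m only uses colors occurring in m, so this finite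
-- search finds every proper coloring with monomial m; see the two lemmas below.
properColorings : (Γ : SignedGraph) → Monomial → List (Coloring (SignedGraph.order Γ))
properColorings Γ m =
  filter (λ κ → proper? Γ κ ×-dec (monomial κ ↭? m))
         (colorings (deduplicate ℤ._≟_ m) (SignedGraph.order Γ))

-- The chromatic signed-symmetric function: the coefficient of m in the sum of
-- the monomials of all proper colorings is the number of those with monomial m.
X : SignedGraph → PowerSeries
X Γ m = List.length (properColorings Γ m)

properColorings-complete : ∀ Γ m κ → Proper Γ κ → monomial κ ↭ m → κ ∈ˡ properColorings Γ m
properColorings-complete Γ m κ p q =
  ∈-filter⁺ _ (go κ (λ x∈κ → ∈-deduplicate⁺ ℤ._≟_ (∈-resp-↭ q x∈κ))) (p , q)
  where
  go : ∀ {n cs} (κ : Coloring n) → (∀ {x} → x ∈ˡ monomial κ → x ∈ˡ cs) → κ ∈ˡ colorings cs n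
  go Vec.[]      _ = here refl
  go (x Vec.∷ κ) h = ∈-cartesianProductWith⁺ Vec._∷_ (h (here refl)) (go κ (h ∘ there))

properColorings-unique : ∀ Γ m → Unique (properColorings Γ m)
properColorings-unique Γ m = filter⁺ _ (go (SignedGraph.order Γ))
  where
  go : ∀ n → Unique (colorings (deduplicate ℤ._≟_ m) n)
  go zero    = [] ∷ []
  go (suc n) = cartesianProductWith⁺ Vec._∷_ ∷-injective (deduplicate-! m) (go n)

------------------------------------------------------------------------
-- Compositions and signed paths

record Composition : Set where
  field
    parts    : List⁺ ℕ
    positive : All⁺.All NonZero parts

  partList : List ℕ
  partList = List⁺.toList parts

  len : ℕ
  len = List⁺.length parts

-- The peak may be any position t; take (suc t) and drop t both contain it.
Unimodal : Composition → Set
Unimodal α = ∃[ t ] Linked _≤_ (take (suc (toℕ t)) partList)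
                  × Linked _≥_ (drop (toℕ {len} t) partList)
  where open Composition α

-- The path on 1 + length s vertices 0, 1, 2, … in which the edge joining
-- k to k + 1 carries the sign lookup s k.
module _ (s : List Sign) where

  Joins : Fin (List.length s) → Rel (Fin (suc (List.length s))) 0ℓ
  Joins k u w = (u ≡ inject₁ k × w ≡ fsuc k) ⊎ (u ≡ fsuc k × w ≡ inject₁ k)

  pathEdges : Sign → EdgeSet (suc (List.length s))
  pathEdges σ = record
    { Adj    = λ u w → ∃[ k ] List.lookup s k ≡ σ × Joins k u w
    ; adj?   = λ u w → any? λ k → (List.lookup s k Sign.≟ σ) ×-dec
                 (((u ≟ᶠ inject₁ k) ×-dec (w ≟ᶠ fsuc k)) ⊎-dec
                  ((u ≟ᶠ fsuc k) ×-dec (w ≟ᶠ inject₁ k)))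
    ; symm   = λ { (k , e , inj₁ (p , q)) → k , e , inj₂ (q , p)
                 ; (k , e , inj₂ (p , q)) → k , e , inj₁ (q , p) }
    ; irrefl = λ { refl (k , _ , inj₁ (p , q)) → distinct k (trans (sym q) p)
                 ; refl (k , _ , inj₂ (p , q)) → distinct k (trans (sym p) q) }
    }
    where
    distinct : ∀ {n} (k : Fin n) → fsuc k ≢ inject₁ k
    distinct (fsuc k) e = distinct k (suc-injective e)

  signedPath : SignedGraph
  signedPath = record
    { order = suc (List.length s)
    ; E⁺    = pathEdges pos
    ; E⁻    = pathEdges neg
    ; loops = Subset.⊥
    }

-- A block of a vertices contributes a - 1 positive edges; consecutive blocks
-- are joined by one negative edge.
pathSigns : ℕ → List ℕ → List Sign
pathSigns a []       = replicate (pred a) pos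
pathSigns a (b ∷ bs) = replicate (pred a) pos ++ neg ∷ pathSigns b bs

P : Composition → SignedGraph
P α = signedPath (pathSigns (List⁺.head parts) (List⁺.tail parts))
  where open Composition α

module Submission where

-- Inclusion–exclusion over the edges writes X (P α) as a signed sum, over all ways of
-- cutting the path into segments, of products of signed power sums
-- p (a , b) = Σ xᵢᵃ x₋ᵢᵇ, where a and b are the sizes of the two switching classes of a
-- segment.  Looking at the coefficient of a leading monomial of a product with as many
-- factors as possible shows that these products are linearly independent, and since the
-- sign of a product is determined by its number of factors, nothing cancels: X (P α)
-- determines the multiset {a , b} of every segment in every segmentation of the path.
--
-- Call a segment pure if all of its edges are positive.  The coarsest segmentation into
-- pure segments gives the multiset of parts, and the trivial segmentation gives the pair
-- of the sums of the odd and of the even parts.  With four parts, segmentations into two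
-- segments moreover give the maximum (one segment pure) and the minimum (both mixed) of
-- the two end parts.  These data determine a composition of length at most four up to
-- reversal.
--
-- A unimodal composition consists of an ascending slope A, copies of the highest part t,
-- and the reverse of an ascending slope B; let A be no longer than B.  Cut off the parts
-- in A and one copy of t as pure segments and keep the rest as one segment.  Another
-- unimodal composition with the same data, with slopes A′ no longer than B′, has a
-- segmentation of this kind as well, in which the pure segments before the one of size t
-- must exhaust A′ or B′.  Hence A′ is no longer than A, and if the lengths agree then one
-- of A′ and B′ is a permutation of A.

open import Defs
open import Algebra.Properties.AbelianGroup using (∙-cancelˡ)
open import Data.Fin.Base as Fin using (Fin; toℕ; inject₁; opposite) renaming (zero to fzero; suc to fsuc)
import Data.Fin.Properties as Fin
open import Data.Fin.Subset.Properties using (∉⊥)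
open import Data.Integer.Base
  using (ℤ; +_; +0; +[1+_]; -[1+_]; +≤+; +<+; 0ℤ; 1ℤ; -_; ∣_∣; ≢-nonZero)
  renaming (_+_ to _⊕_; _*_ to _⊛_; _-_ to _⊖_; _≤_ to _≤ℤ_; _<_ to _<ℤ_)
import Data.Integer.Properties as ℤ
open import Data.Integer.Tactic.RingSolver using (solve-∀)
open import Data.List.Base as List
  using (List; []; _∷_; [_]; _++_; _∷ʳ_; map; length; filter; replicate; reverse; take; drop; deduplicate; cartesianProductWith)
open import Data.List.Membership.Propositional using (_∈_)
open import Data.List.Membership.Propositional.Properties
  using (∈-++⁺ˡ; ∈-++⁺ʳ; ∈-++⁻; ∈-map⁺; ∈-map⁻; ∈-∃++; ∈-filter⁺; ∈-filter⁻;
         ∈-deduplicate⁺; ∈-deduplicate⁻; ∈-cartesianProductWith⁺)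
open import Data.List.Membership.Propositional.Properties.WithK using (unique∧set⇒bag)
import Data.List.NonEmpty.Base as List⁺
import Data.List.NonEmpty.Relation.Unary.All as All⁺
import Data.List.Properties as List
open import Data.List.Relation.Binary.BagAndSetEquality using (∼bag⇒↭)
open import Data.List.Relation.Binary.Permutation.Propositional
  using (_↭_; refl; prep; swap; trans; ↭-refl; ↭-sym; ↭-trans; ↭-reflexive; module PermutationReasoning)
import Data.List.Relation.Binary.Permutation.Propositional.Properties as ↭
open ↭
  using (∈-resp-↭; ↭-length; shift; drop-∷; drop-mid; ++⁺ˡ; ++⁺ʳ; ++-comm; filter-↭; ↭-reverse; ↭-singleton-inv)
open import Data.List.Relation.Unary.All as All using (All; []; _∷_)
import Data.List.Relation.Unary.All.Properties as All
open import Data.List.Relation.Unary.AllPairs using (AllPairs; []; _∷_)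
import Data.List.Relation.Unary.AllPairs.Properties as AllPairs
open import Data.List.Relation.Unary.Any using (here; there)
open import Data.List.Relation.Unary.Linked using (Linked)
import Data.List.Relation.Unary.Linked.Properties as Linked
open import Data.List.Relation.Unary.Unique.DecPropositional.Properties ℤ._≟_ using (deduplicate-!)
open import Data.List.Relation.Unary.Unique.Propositional using (Unique)
import Data.List.Relation.Unary.Unique.Propositional.Properties as Unique
open import Data.Nat.Base
  using (ℕ; zero; suc; pred; _+_; _∸_; _⊔_; _⊓_; _≤_; _<_; z≤n; s≤s; s≤s⁻¹; NonZero; >-nonZero⁻¹)
import Data.Nat.Properties as ℕ
open import Data.Product.Base as Product using (∃-syntax; _×_; _,_; proj₁; proj₂)
open import Data.Product.Properties using (,-injective)
open import Data.Sign.Base as Sign using (Sign) renaming (+ to pos; - to neg)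
open import Data.Sum.Base as Sum using (_⊎_; inj₁; inj₂; [_,_]′)
open import Data.Unit.Base using (⊤; tt)
open import Data.Vec.Base using (Vec; []; _∷_; lookup; toList)
open import Data.Vec.Properties using (∷-injective; length-toList)
open import Function.Base using (_∘_; id)
open import Function.Bundles using (_⇔_; mk⇔; Equivalence; mk↔ₛ′)
open import Relation.Binary.PropositionalEquality as ≡
  using (_≡_; _≢_; refl; sym; cong; cong₂; subst; subst₂; module ≡-Reasoning)
open import Relation.Nullary.Decidable using (Dec; yes; no; ¬?; _×-dec_)
open import Relation.Nullary.Negation using (¬_; contradiction)

private
  variable
    A B : Set
    s : List Sign
    σ : Sign
    u : List Sign
    us : List (List Sign)

-- Finite sums of integers

∑ : (A → ℤ) → List A → ℤ
∑ f []       = 0ℤ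
∑ f (x ∷ xs) = f x ⊕ ∑ f xs

∑-cong : {f g : A → ℤ} (xs : List A) → (∀ {x} → x ∈ xs → f x ≡ g x) → ∑ f xs ≡ ∑ g xs
∑-cong []       h = refl
∑-cong (x ∷ xs) h = cong₂ _⊕_ (h (here refl)) (∑-cong xs (h ∘ there))

∑-++ : (f : A → ℤ) (xs ys : List A) → ∑ f (xs ++ ys) ≡ ∑ f xs ⊕ ∑ f ys
∑-++ f []       ys = sym (ℤ.+-identityˡ _)
∑-++ f (x ∷ xs) ys = ≡.trans (cong (f x ⊕_) (∑-++ f xs ys)) (sym (ℤ.+-assoc (f x) _ _))

∑-map : (f : B → ℤ) (h : A → B) (xs : List A) → ∑ f (map h xs) ≡ ∑ (f ∘ h) xs
∑-map f h []       = refl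
∑-map f h (x ∷ xs) = cong (f (h x) ⊕_) (∑-map f h xs)

∑-0 : (xs : List A) → ∑ (λ _ → 0ℤ) xs ≡ 0ℤ
∑-0 []       = refl
∑-0 (x ∷ xs) = ≡.trans (ℤ.+-identityˡ _) (∑-0 xs)

∑-+ : (f g : A → ℤ) (xs : List A) → ∑ (λ x → f x ⊕ g x) xs ≡ ∑ f xs ⊕ ∑ g xs
∑-+ f g []       = refl
∑-+ f g (x ∷ xs) = ≡.trans (cong (f x ⊕ g x ⊕_) (∑-+ f g xs)) (exchange (f x) (g x) _ _)
  where
  exchange : ∀ a b c d → (a ⊕ b) ⊕ (c ⊕ d) ≡ (a ⊕ c) ⊕ (b ⊕ d)
  exchange = solve-∀

∑-*ˡ : (k : ℤ) (f : A → ℤ) (xs : List A) → ∑ (λ x → k ⊛ f x) xs ≡ k ⊛ ∑ f xs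
∑-*ˡ k f []       = sym (ℤ.*-zeroʳ k)
∑-*ˡ k f (x ∷ xs) = ≡.trans (cong (k ⊛ f x ⊕_) (∑-*ˡ k f xs)) (sym (ℤ.*-distribˡ-+ k _ _))

∑-swap : (f : A → B → ℤ) (xs : List A) (ys : List B) →
         ∑ (λ x → ∑ (f x) ys) xs ≡ ∑ (λ y → ∑ (λ x → f x y) xs) ys
∑-swap f []       ys = sym (∑-0 ys)
∑-swap f (x ∷ xs) ys =
  ≡.trans (cong (∑ (f x) ys ⊕_) (∑-swap f xs ys)) (sym (∑-+ (f x) _ ys))

∑-↭ : (f : A → ℤ) {xs ys : List A} → xs ↭ ys → ∑ f xs ≡ ∑ f ys
∑-↭ f refl         = refl
∑-↭ f (prep x p)   = cong (f x ⊕_) (∑-↭ f p)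
∑-↭ f (swap x y p) = ≡.trans (cong (λ z → f x ⊕ (f y ⊕ z)) (∑-↭ f p)) (exchange (f x) (f y) _)
  where
  exchange : ∀ a b c → a ⊕ (b ⊕ c) ≡ b ⊕ (a ⊕ c)
  exchange = solve-∀
∑-↭ f (trans p q)  = ≡.trans (∑-↭ f p) (∑-↭ f q)

∑-cartesianProductWith : ∀ {C : Set} (f : C → ℤ) (h : A → B → C) xs ys →
  ∑ f (cartesianProductWith h xs ys) ≡ ∑ (λ x → ∑ (λ y → f (h x y)) ys) xs
∑-cartesianProductWith f h []       ys = refl
∑-cartesianProductWith f h (x ∷ xs) ys =
  ≡.trans (∑-++ f (map (h x) ys) _)
          (cong₂ _⊕_ (∑-map f (h x) ys) (∑-cartesianProductWith f h xs ys))

∑-≢0 : (f : A → ℤ) (xs : List A) → ∑ f xs ≢ 0ℤ → ∃[ x ] x ∈ xs × f x ≢ 0ℤ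
∑-≢0 f []       ≢0 = contradiction refl ≢0
∑-≢0 f (x ∷ xs) ≢0 with f x ℤ.≟ 0ℤ
... | no  fx≢0 = x , here refl , fx≢0
... | yes fx≡0 with ∑-≢0 f xs (λ e → ≢0 (cong₂ _⊕_ fx≡0 e))
...   | y , y∈xs , fy≢0 = y , there y∈xs , fy≢0

∑-nonneg : (f : A → ℤ) (xs : List A) → (∀ x → 0ℤ ≤ℤ f x) → 0ℤ ≤ℤ ∑ f xs
∑-nonneg f []       h = ℤ.≤-refl
∑-nonneg f (x ∷ xs) h = ℤ.+-mono-≤ (h x) (∑-nonneg f xs h)

∑-pos : (f : A → ℤ) {xs : List A} {x : A} → (∀ x → 0ℤ ≤ℤ f x) → x ∈ xs → 0ℤ <ℤ f x → 0ℤ <ℤ ∑ f xs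
∑-pos f {_ ∷ xs} h (here refl) 0<fx = ℤ.+-mono-<-≤ 0<fx (∑-nonneg f xs h)
∑-pos f {y ∷ _}  h (there x∈)  0<fx = ℤ.+-mono-≤-< (h y) (∑-pos f h x∈ 0<fx)

-- Iverson brackets

⟦_⟧ : {P : Set} → Dec P → ℤ
⟦ yes _ ⟧ = 1ℤ
⟦ no  _ ⟧ = 0ℤ

⟦⟧-yes : {P : Set} (d : Dec P) → P → ⟦ d ⟧ ≡ 1ℤ
⟦⟧-yes (yes _) p = refl
⟦⟧-yes (no ¬p) p = contradiction p ¬p

⟦⟧-no : {P : Set} (d : Dec P) → ¬ P → ⟦ d ⟧ ≡ 0ℤ
⟦⟧-no (yes p) ¬p = contradiction p ¬p
⟦⟧-no (no _)  ¬p = refl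

⟦⟧-⇔ : {P Q : Set} (d : Dec P) (e : Dec Q) → P ⇔ Q → ⟦ d ⟧ ≡ ⟦ e ⟧
⟦⟧-⇔ (yes p) e P⇔Q = sym (⟦⟧-yes e (Equivalence.to P⇔Q p))
⟦⟧-⇔ (no ¬p) e P⇔Q = sym (⟦⟧-no e (¬p ∘ Equivalence.from P⇔Q))

⟦⟧-× : {P Q : Set} (d : Dec P) (e : Dec Q) → ⟦ d ×-dec e ⟧ ≡ ⟦ d ⟧ ⊛ ⟦ e ⟧
⟦⟧-× (yes _) (yes _) = refl
⟦⟧-× (yes _) (no _)  = refl
⟦⟧-× (no _)  (yes _) = refl
⟦⟧-× (no _)  (no _)  = refl

⟦⟧-nonneg : {P : Set} (d : Dec P) → 0ℤ ≤ℤ ⟦ d ⟧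
⟦⟧-nonneg (yes _) = +≤+ z≤n
⟦⟧-nonneg (no _)  = ℤ.≤-refl

length-filter-∑ : {P : A → Set} (P? : ∀ x → Dec (P x)) (xs : List A) →
                  + length (filter P? xs) ≡ ∑ (λ x → ⟦ P? x ⟧) xs
length-filter-∑ P? []       = refl
length-filter-∑ P? (x ∷ xs) with P? x
... | yes _ = cong (1ℤ ⊕_) (length-filter-∑ P? xs)
... | no  _ = ≡.trans (length-filter-∑ P? xs) (sym (ℤ.+-identityˡ _))

-- Trades the constraint imposed by one edge for an unconstrained sum and a single correction term.
-- `Unique` ensures that the term at `x` is met only once.
∑-⟦≢⟧ : (H : ℤ → ℤ) {x : ℤ} {cs : List ℤ} → Unique cs → x ∈ cs →
         ∑ (λ d → ⟦ ¬? (d ℤ.≟ x) ⟧ ⊛ H d) cs ⊕ H x ≡ ∑ H cs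
∑-⟦≢⟧ H {x} {c ∷ cs} (c∉cs ∷ _) (here refl) = begin
  (⟦ ¬? (x ℤ.≟ x) ⟧ ⊛ H x ⊕ ∑ (λ d → ⟦ ¬? (d ℤ.≟ x) ⟧ ⊛ H d) cs) ⊕ H x
    ≡⟨ cong₂ (λ a b → (a ⊛ H x ⊕ b) ⊕ H x) (⟦⟧-no (¬? (x ℤ.≟ x)) (λ ne → ne refl))
         (∑-cong cs (λ d∈ → ≡.trans (cong (_⊛ H _) (⟦⟧-yes (¬? (_ ℤ.≟ x)) (All.lookup c∉cs d∈ ∘ sym))) (ℤ.*-identityˡ _))) ⟩
  (0ℤ ⊛ H x ⊕ ∑ H cs) ⊕ H x
    ≡⟨ arith (H x) (∑ H cs) ⟩
  H x ⊕ ∑ H cs ∎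
  where
  open ≡-Reasoning
  arith : ∀ a b → (0ℤ ⊛ a ⊕ b) ⊕ a ≡ a ⊕ b
  arith = solve-∀
∑-⟦≢⟧ H {x} {c ∷ cs} (c∉cs ∷ u) (there x∈cs) = begin
  (⟦ ¬? (c ℤ.≟ x) ⟧ ⊛ H c ⊕ S) ⊕ H x
    ≡⟨ cong (λ a → (a ⊛ H c ⊕ S) ⊕ H x) (⟦⟧-yes (¬? (c ℤ.≟ x)) (All.lookup c∉cs x∈cs)) ⟩
  (1ℤ ⊛ H c ⊕ S) ⊕ H x
    ≡⟨ arith (H c) S (H x) ⟩
  H c ⊕ (S ⊕ H x)
    ≡⟨ cong (H c ⊕_) (∑-⟦≢⟧ H u x∈cs) ⟩
  H c ⊕ ∑ H cs ∎
  where
  open ≡-Reasoning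
  S = ∑ (λ d → ⟦ ¬? (d ℤ.≟ x) ⟧ ⊛ H d) cs
  arith : ∀ a b c → (1ℤ ⊛ a ⊕ b) ⊕ c ≡ a ⊕ (b ⊕ c)
  arith = solve-∀

-- Proper colorings of signed paths

act : Sign → ℤ → ℤ
act pos c = c
act neg c = - c

-- Properness read along the path: each vertex is compared with its predecessor only. Keeping the
-- first color as a separate argument lets inductions peel off one edge at a time.
Chain : (s : List Sign) → ℤ → Vec ℤ (length s) → Set
Chain []      c []      = ⊤
Chain (σ ∷ s) c (d ∷ κ) = d ≢ act σ c × Chain s d κ

chain? : ∀ s c κ → Dec (Chain s c κ)
chain? []      c []      = yes tt
chain? (σ ∷ s) c (d ∷ κ) = ¬? (d ℤ.≟ act σ c) ×-dec chain? s d κ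

Edgewise : (s : List Sign) → Coloring (suc (length s)) → Set
Edgewise s κ = ∀ k → lookup κ (fsuc k) ≢ act (List.lookup s k) (lookup κ (inject₁ k))

chain⇒edgewise : ∀ s {c κ} → Chain s c κ → Edgewise s (c ∷ κ)
chain⇒edgewise (σ ∷ s) {κ = d ∷ κ} (d≢ , ch) fzero    = d≢
chain⇒edgewise (σ ∷ s) {κ = d ∷ κ} (d≢ , ch) (fsuc k) = chain⇒edgewise s ch k

edgewise⇒chain : ∀ s {c κ} → Edgewise s (c ∷ κ) → Chain s c κ
edgewise⇒chain []      {κ = []}    e = tt
edgewise⇒chain (σ ∷ s) {κ = d ∷ κ} e = e fzero , edgewise⇒chain s (e ∘ fsuc)

edgewise⇒proper : ∀ s {κ} → Edgewise s κ → Proper (signedPath s) κ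
edgewise⇒proper s {κ} e = positive , negative , λ v v∈⊥ → contradiction v∈⊥ ∉⊥
  where
  e⁺ : ∀ k → List.lookup s k ≡ pos → lookup κ (fsuc k) ≢ lookup κ (inject₁ k)
  e⁺ k s≡ = subst (λ σ → lookup κ (fsuc k) ≢ act σ (lookup κ (inject₁ k))) s≡ (e k)
  e⁻ : ∀ k → List.lookup s k ≡ neg → lookup κ (fsuc k) ≢ - lookup κ (inject₁ k)
  e⁻ k s≡ = subst (λ σ → lookup κ (fsuc k) ≢ act σ (lookup κ (inject₁ k))) s≡ (e k)
  positive : ∀ v w → _ → lookup κ v ≢ lookup κ w
  positive v w (k , s≡ , inj₁ (refl , refl)) eq = e⁺ k s≡ (sym eq)
  positive v w (k , s≡ , inj₂ (refl , refl)) eq = e⁺ k s≡ eq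
  negative : ∀ v w → _ → lookup κ v ≢ - lookup κ w
  negative v w (k , s≡ , inj₁ (refl , refl)) eq =
    e⁻ k s≡ (≡.trans (sym (ℤ.neg-involutive _)) (cong -_ (sym eq)))
  negative v w (k , s≡ , inj₂ (refl , refl)) eq = e⁻ k s≡ eq

proper⇒edgewise : ∀ s {κ} → Proper (signedPath s) κ → Edgewise s κ
proper⇒edgewise s {κ} (positive , negative , _) k with List.lookup s k in eq
... | pos = positive (fsuc k) (inject₁ k) (k , eq , inj₂ (refl , refl))
... | neg = negative (fsuc k) (inject₁ k) (k , eq , inj₂ (refl , refl))

proper⇔chain : ∀ s c κ → Proper (signedPath s) (c ∷ κ) ⇔ Chain s c κ
proper⇔chain s c κ =
  mk⇔ (edgewise⇒chain s ∘ proper⇒edgewise s {c ∷ κ}) (edgewise⇒proper s {c ∷ κ} ∘ chain⇒edgewise s)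

-- Inclusion–exclusion over the edges of a path

-- A segment is recorded by the signs of its inner edges, so `[]` is a single vertex, and the sign
-- of a cut edge is dropped. The first segment is kept apart because there always is one.
segmentations : List Sign → List (List Sign × List (List Sign))
segmentations []      = [ [] , [] ]
segmentations (σ ∷ s) = map (λ (u , us) → [] , u ∷ us) (segmentations s)
                     ++ map (λ (u , us) → σ ∷ u , us)  (segmentations s)

-- The colors on a segment all of whose edges are improperly colored.
spread : List Sign → ℤ → List ℤ
spread []      c = [ c ]
spread (σ ∷ u) c = c ∷ spread u (act σ c)

sgn : ℕ → ℤ
sgn zero    = 1ℤ
sgn (suc n) = - sgn n

module _ (C : List ℤ) where

  -- The first vertices of the segments are colored independently. The continuation `g` receives the
  -- resulting word and stands for the extraction of a coefficient.
  spreads : List (List Sign) → (List ℤ → ℤ) → ℤ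
  spreads []       g = g []
  spreads (u ∷ us) g = ∑ (λ c → spreads us (λ w → g (spread u c ++ w))) C

  module _ (C! : Unique C) (C-act : ∀ σ {c} → c ∈ C → act σ c ∈ C) where

    -- Expands the product over all edges of 1 minus the indicator of an improperly colored edge;
    -- choosing the indicator joins the edge. Since `length us` counts the cut edges, the two signs
    -- combine to the parity of the number of joined edges.
    inclusion-exclusion-from : ∀ s {c} → c ∈ C → (g : List ℤ → ℤ) →
      ∑ (λ κ → ⟦ chain? s c κ ⟧ ⊛ g (c ∷ toList κ)) (colorings C (length s)) ≡
      sgn (length s) ⊛ ∑ (λ (u , us) → sgn (length us) ⊛ spreads us (λ w → g (spread u c ++ w)))
                           (segmentations s)
    inclusion-exclusion-from []      {c} c∈C g = arith (g (c ∷ []))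
      where
      arith : ∀ x → 1ℤ ⊛ x ⊕ 0ℤ ≡ 1ℤ ⊛ (1ℤ ⊛ x ⊕ 0ℤ)
      arith = solve-∀
    inclusion-exclusion-from (σ ∷ s) {c} c∈C g = begin
      ∑ (λ κ → ⟦ chain? (σ ∷ s) c κ ⟧ ⊛ g (c ∷ toList κ)) (colorings C (suc n))
        ≡⟨ ∑-cartesianProductWith _ _∷_ C (colorings C n) ⟩
      ∑ (λ d → ∑ (λ κ → ⟦ ¬? (d ℤ.≟ act σ c) ×-dec chain? s d κ ⟧ ⊛ g′ (d ∷ toList κ)) (colorings C n)) C
        ≡⟨ ∑-cong C (λ {d} d∈C → ≡.trans
             (∑-cong (colorings C n) (λ {κ} _ → ≡.trans
               (cong (_⊛ g′ (d ∷ toList κ)) (⟦⟧-× (¬? (d ℤ.≟ act σ c)) (chain? s d κ)))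
               (ℤ.*-assoc ⟦ ¬? (d ℤ.≟ act σ c) ⟧ _ _)))
             (∑-*ˡ ⟦ ¬? (d ℤ.≟ act σ c) ⟧ _ (colorings C n))) ⟩
      ∑ (λ d → ⟦ ¬? (d ℤ.≟ act σ c) ⟧ ⊛ F d) C
        -- The full sum over `d` corresponds to cutting the first edge, the subtracted term at the
        -- forbidden color to joining it. That color lies in `C` by `C-act`.
        ≡⟨ subtract (∑-⟦≢⟧ F C! (C-act σ c∈C)) ⟩
      ∑ F C ⊖ F (act σ c)
        ≡⟨ cong₂ _⊖_ (∑-cong C (λ d∈C → inclusion-exclusion-from s d∈C g′))
                       (inclusion-exclusion-from s (C-act σ c∈C) g′) ⟩
      ∑ (λ d → e ⊛ ∑ (G d) S) C ⊖ e ⊛ ∑ (G (act σ c)) S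
        ≡⟨ cong (_⊖ (e ⊛ ∑ (G (act σ c)) S))
             (≡.trans (∑-*ˡ e _ C) (cong (e ⊛_) (∑-swap G C S))) ⟩
      e ⊛ ∑ (λ p → ∑ (λ d → G d p) C) S ⊖ e ⊛ ∑ (G (act σ c)) S
        ≡⟨ cong (λ z → e ⊛ z ⊖ e ⊛ ∑ (G (act σ c)) S)
             (∑-cong S (λ {(u , us)} _ → ∑-*ˡ (sgn (length us)) _ C)) ⟩
      e ⊛ ∑ K S ⊖ e ⊛ ∑ (G (act σ c)) S
        ≡⟨ arith e (∑ K S) (∑ (G (act σ c)) S) ⟩
      - e ⊛ (- 1ℤ ⊛ ∑ K S ⊕ ∑ (G (act σ c)) S)
        ≡⟨ cong (λ z → - e ⊛ (z ⊕ ∑ (G (act σ c)) S)) (sym (≡.trans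
             (∑-cong S (λ {(u , us)} _ → negate (sgn (length us)) _)) (∑-*ˡ (- 1ℤ) K S))) ⟩
      - e ⊛ (∑ (λ (u , us) → - sgn (length us) ⊛ spreads (u ∷ us) g′) S ⊕ ∑ (G (act σ c)) S)
        ≡⟨ cong (- e ⊛_) (sym (≡.trans (∑-++ _ (map _ S) _) (cong₂ _⊕_ (∑-map _ _ S) (∑-map _ _ S)))) ⟩
      - e ⊛ ∑ (λ (u , us) → sgn (length us) ⊛ spreads us (λ w → g (spread u c ++ w)))
                (segmentations (σ ∷ s)) ∎
      where
      open ≡-Reasoning
      n  = length s
      S  = segmentations s
      e  = sgn n
      g′ : List ℤ → ℤ
      g′ w = g (c ∷ w)
      F : ℤ → ℤ
      F d = ∑ (λ κ → ⟦ chain? s d κ ⟧ ⊛ g′ (d ∷ toList κ)) (colorings C n)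
      G : ℤ → List Sign × List (List Sign) → ℤ
      G d (u , us) = sgn (length us) ⊛ spreads us (λ w → g′ (spread u d ++ w))
      K : List Sign × List (List Sign) → ℤ
      K (u , us) = sgn (length us) ⊛ spreads (u ∷ us) g′
      subtract : ∀ {a b c} → a ⊕ b ≡ c → a ≡ c ⊖ b
      subtract {a} {b} refl = cancel a b
        where
        cancel : ∀ a b → a ≡ (a ⊕ b) ⊖ b
        cancel = solve-∀
      arith : ∀ e a b → e ⊛ a ⊖ e ⊛ b ≡ - e ⊛ (- 1ℤ ⊛ a ⊕ b)
      arith = solve-∀
      negate : ∀ a b → - a ⊛ b ≡ - 1ℤ ⊛ (a ⊛ b)
      negate = solve-∀

    inclusion-exclusion : ∀ s (g : List ℤ → ℤ) →
      ∑ (λ κ → ⟦ proper? (signedPath s) κ ⟧ ⊛ g (monomial κ)) (colorings C (suc (length s))) ≡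
      sgn (length s) ⊛ ∑ (λ (u , us) → sgn (length us) ⊛ spreads (u ∷ us) g) (segmentations s)
    inclusion-exclusion s g = begin
      ∑ (λ κ → ⟦ proper? (signedPath s) κ ⟧ ⊛ g (monomial κ)) (colorings C (suc (length s)))
        ≡⟨ ∑-cartesianProductWith _ _∷_ C (colorings C (length s)) ⟩
      ∑ (λ c → ∑ (λ κ → ⟦ proper? (signedPath s) (c ∷ κ) ⟧ ⊛ g (c ∷ toList κ)) (colorings C (length s))) C
        ≡⟨ ∑-cong C (λ {c} c∈C → ≡.trans
             (∑-cong (colorings C (length s)) (λ {κ} _ → cong (_⊛ g (c ∷ toList κ))
               (⟦⟧-⇔ (proper? (signedPath s) (c ∷ κ)) (chain? s c κ) (proper⇔chain s c κ))))
             (inclusion-exclusion-from s c∈C g)) ⟩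
      ∑ (λ c → e ⊛ ∑ (λ (u , us) → sgn (length us) ⊛ spreads us (λ w → g (spread u c ++ w))) S) C
        ≡⟨ ≡.trans (∑-*ˡ e _ C) (cong (e ⊛_) (∑-swap _ C S)) ⟩
      e ⊛ ∑ (λ (u , us) → ∑ (λ c → sgn (length us) ⊛ spreads us (λ w → g (spread u c ++ w))) C) S
        ≡⟨ cong (e ⊛_) (∑-cong S (λ {(u , us)} _ → ∑-*ˡ (sgn (length us)) _ C)) ⟩
      e ⊛ ∑ (λ (u , us) → sgn (length us) ⊛ spreads (u ∷ us) g) S ∎
      where
      open ≡-Reasoning
      e = sgn (length s)
      S = segmentations s

-- The palette of a monomial: closed under negation, and large enough for all
-- colorings with that monomial.
palette : Monomial → List ℤ
palette m = deduplicate ℤ._≟_ (m ++ map -_ m)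

palette-unique : ∀ m → Unique (palette m)
palette-unique m = deduplicate-! (m ++ map -_ m)

∈-palette⁺ : ∀ {m c} → c ∈ m → c ∈ palette m
∈-palette⁺ c∈m = ∈-deduplicate⁺ ℤ._≟_ (∈-++⁺ˡ c∈m)

palette-neg : ∀ m {c} → c ∈ palette m → - c ∈ palette m
palette-neg m c∈ with ∈-++⁻ m (∈-deduplicate⁻ ℤ._≟_ (m ++ map -_ m) c∈)
... | inj₁ c∈m = ∈-deduplicate⁺ ℤ._≟_ (∈-++⁺ʳ m (∈-map⁺ -_ c∈m))
... | inj₂ c∈-m with ∈-map⁻ -_ c∈-m
...   | d , d∈m , refl = subst (_∈ palette m) (sym (ℤ.neg-involutive d)) (∈-palette⁺ d∈m)

palette-act : ∀ m σ {c} → c ∈ palette m → act σ c ∈ palette m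
palette-act m pos = λ c∈ → c∈
palette-act m neg = palette-neg m

colorings-unique : ∀ {cs} → Unique cs → ∀ n → Unique (colorings cs n)
colorings-unique cs! zero    = [] ∷ []
colorings-unique cs! (suc n) = Unique.cartesianProductWith⁺ _∷_ ∷-injective cs! (colorings-unique cs! n)

∈-colorings⁺ : ∀ {n cs} (κ : Coloring n) → (∀ {x} → x ∈ monomial κ → x ∈ cs) → κ ∈ colorings cs n
∈-colorings⁺ []      _ = here refl
∈-colorings⁺ (x ∷ κ) h = ∈-cartesianProductWith⁺ _∷_ (h (here refl)) (∈-colorings⁺ κ (h ∘ there))

-- Inclusion-exclusion requires colors closed under negation, which those occurring in `m` need not
-- be. A coloring using any further color has a monomial different from `m`, so both searches are
-- duplicate-free lists with the same members.
X-palette : ∀ Γ m → + X Γ m ≡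
  ∑ (λ κ → ⟦ proper? Γ κ ⟧ ⊛ ⟦ monomial κ ↭? m ⟧) (colorings (palette m) (SignedGraph.order Γ))
X-palette Γ m = begin
  + X Γ m
    ≡⟨ cong +_ (↭-length (∼bag⇒↭ (unique∧set⇒bag (properColorings-unique Γ m) (Unique.filter⁺ D? all!)
         (mk⇔ (λ κ∈ → let _ , p , q = ∈-filter⁻ D? {xs = colorings (deduplicate ℤ._≟_ m) n} κ∈ in
                 ∈-filter⁺ D? (∈-colorings⁺ _ (λ x∈ → ∈-palette⁺ (∈-resp-↭ q x∈))) (p , q))
              (λ κ∈ → let _ , p , q = ∈-filter⁻ D? {xs = all} κ∈ in properColorings-complete Γ m _ p q))))) ⟩
  + length (filter D? all)
    ≡⟨ length-filter-∑ D? all ⟩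
  ∑ (λ κ → ⟦ D? κ ⟧) all
    ≡⟨ ∑-cong all (λ {κ} _ → ⟦⟧-× (proper? Γ κ) (monomial κ ↭? m)) ⟩
  ∑ (λ κ → ⟦ proper? Γ κ ⟧ ⊛ ⟦ monomial κ ↭? m ⟧) all ∎
  where
  open ≡-Reasoning
  n = SignedGraph.order Γ
  D? = λ κ → proper? Γ κ ×-dec (monomial κ ↭? m)
  all = colorings (palette m) n
  all! = colorings-unique (palette-unique m) n

X-signedPath : ∀ s m → + X (signedPath s) m ≡
  sgn (length s) ⊛ ∑ (λ (u , us) → sgn (length us) ⊛ spreads (palette m) (u ∷ us) (λ w → ⟦ w ↭? m ⟧))
                       (segmentations s)
X-signedPath s m = ≡.trans (X-palette (signedPath s) m)
  (inclusion-exclusion (palette m) (palette-unique m) (palette-act m) s (λ w → ⟦ w ↭? m ⟧))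

-- The degree of `X`

alternating : (s : List Sign) → ℤ → Vec ℤ (length s)
alternating []      c = []
alternating (σ ∷ s) c = - act σ c ∷ alternating s (- act σ c)

-- Each color is the negative of the forbidden one, and differs from it because it is nonzero.
alternating-chain : ∀ s {c} → c ≢ 0ℤ → Chain s c (alternating s c)
alternating-chain []      c≢0 = tt
alternating-chain (σ ∷ s) {c} c≢0 = self-neg , alternating-chain s (actσ≢0 σ ∘ ≡.trans (sym (ℤ.neg-involutive _)) ∘ cong -_)
  where
  actσ≢0 : ∀ σ → act σ c ≢ 0ℤ
  actσ≢0 pos e = c≢0 e
  actσ≢0 neg e = c≢0 (≡.trans (sym (ℤ.neg-involutive c)) (cong -_ e))
  -x≢x : ∀ {x} → x ≢ 0ℤ → - x ≢ x
  -x≢x {+0}       x≢0 _ = x≢0 refl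
  -x≢x {+[1+ n ]} x≢0 ()
  -x≢x { -[1+ n ]} x≢0 ()
  self-neg : - act σ c ≢ act σ c
  self-neg = -x≢x (actσ≢0 σ)

-- `X` is homogeneous of degree the number of vertices, so a single occurring monomial reveals that
-- number. The alternating coloring starting at 1 supplies one.
X-length : ∀ s s′ → X (signedPath s) ≐ X (signedPath s′) → length s ≡ length s′
X-length s s′ X≐ = ℕ.suc-injective (begin
  suc (length s)             ≡⟨ length-toList κ ⟨
  length m                   ≡⟨ found (properColorings (signedPath s′) m) (λ κ′∈ → proj₂ (proj₂ (∈-filter⁻ D? {xs = colorings (deduplicate ℤ._≟_ m) (suc (length s′))} κ′∈))) (X≐ m)
                                  (properColorings-complete (signedPath s) m κ κ-proper ↭-refl) ⟩
  suc (length s′)            ∎)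
  where
  open ≡-Reasoning
  κ = 1ℤ ∷ alternating s 1ℤ
  m = monomial κ
  κ-proper = Equivalence.from (proper⇔chain s 1ℤ (alternating s 1ℤ)) (alternating-chain s (λ ()))
  D? = λ κ → proper? (signedPath s′) κ ×-dec (monomial κ ↭? m)
  found : ∀ {n} {xs : List A} {x : A} (ys : List (Coloring n)) → (∀ {y} → y ∈ ys → monomial y ↭ m) →
          length xs ≡ length ys → x ∈ xs → length m ≡ n
  found (y ∷ ys) h _  _  = ≡.trans (sym (↭-length (h (here refl)))) (length-toList y)
  found []       h () (here _)
  found []       h () (there _)

-- The color classes of a segment

-- Once a color c is chosen for the first vertex of a segment all of whose edges
-- are improperly colored, a vertices have color c and b vertices have color - c.
Type : Set
Type = ℕ × ℕ

ty : List Sign → Type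
ty []        = 1 , 0
ty (pos ∷ u) = let a , b = ty u in suc a , b
ty (neg ∷ u) = let a , b = ty u in suc b , a

word : Type → ℤ → List ℤ
word (a , b) c = replicate a c ++ replicate b (- c)

-- The sorted representative of an unordered pair: replacing the base color `c` by `- c` exchanges
-- the two classes, so p (a , b) = p (b , a).
norm : Type → Type
norm (a , b) = a ⊔ b , a ⊓ b

kind : List Sign → Type
kind u = norm (ty u)

norm-swap : ∀ a b → norm (a , b) ≡ norm (b , a)
norm-swap a b = cong₂ _,_ (ℕ.⊔-comm a b) (ℕ.⊓-comm a b)

norm-cases : ∀ a b → norm (a , b) ≡ (a , b) ⊎ norm (a , b) ≡ (b , a)
norm-cases a b with ℕ.≤-total a b
... | inj₁ a≤b = inj₂ (cong₂ _,_ (ℕ.m≤n⇒m⊔n≡n a≤b) (ℕ.m≤n⇒m⊓n≡m a≤b))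
... | inj₂ b≤a = inj₁ (cong₂ _,_ (ℕ.m≥n⇒m⊔n≡m b≤a) (ℕ.m≥n⇒m⊓n≡n b≤a))

norm-idem : ∀ t → norm (norm t) ≡ norm t
norm-idem (a , b) with norm-cases a b
... | inj₁ e = cong norm e
... | inj₂ e = ≡.trans (cong norm e) (norm-swap b a)

word-swap : ∀ a b c → word (b , a) c ↭ word (a , b) (- c)
word-swap a b c = ↭-trans (++-comm (replicate b c) _)
  (↭-reflexive (cong (λ z → replicate a (- c) ++ replicate b z) (sym (ℤ.neg-involutive c))))

spread↭word : ∀ u c → spread u c ↭ word (ty u) c
spread↭word []        c = ↭-refl
spread↭word (pos ∷ u) c = prep c (spread↭word u c)
spread↭word (neg ∷ u) c =
  prep c (↭-trans (spread↭word u (- c)) (↭-sym (word-swap (proj₁ (ty u)) (proj₂ (ty u)) c)))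

∈-word⁻ : ∀ {a b c x} → x ∈ word (a , b) c → ∣ x ∣ ≡ ∣ c ∣
∈-word⁻ {a} {b} {c} x∈ with ∈-++⁻ (replicate a c) x∈
... | inj₁ x∈ = All.lookup {P = λ y → ∣ y ∣ ≡ ∣ c ∣} (All.replicate⁺ a refl) x∈
... | inj₂ x∈ = All.lookup {P = λ y → ∣ y ∣ ≡ ∣ c ∣} (All.replicate⁺ b (ℤ.∣-i∣≡∣i∣ c)) x∈

-- Counting the copies of `c` gives the first entry, and the length then gives the second. At color
-- 0 only the sum of the entries would be visible.
word-injective : ∀ {a b a′ b′ c} → c ≢ - c → word (a , b) c ↭ word (a′ , b′) c → a ≡ a′ × b ≡ b′
word-injective {a} {b} {a′} {b′} {c} c≢-c p = a≡a′ , ℕ.+-cancelˡ-≡ a b b′ (begin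
  a + b                   ≡⟨ total a b ⟨
  length (word (a , b) c) ≡⟨ ↭-length p ⟩
  length (word (a′ , b′) c) ≡⟨ total a′ b′ ⟩
  a′ + b′                 ≡⟨ cong (_+ b′) a≡a′ ⟨
  a + b′                  ∎)
  where
  open ≡-Reasoning
  total : ∀ a b → length (word (a , b) c) ≡ a + b
  total a b = ≡.trans (List.length-++ (replicate a c)) (cong₂ _+_ (List.length-replicate a) (List.length-replicate b))
  count : ∀ a b → length (filter (ℤ._≟ c) (word (a , b) c)) ≡ a
  count a b = begin
    length (filter (ℤ._≟ c) (word (a , b) c))
      ≡⟨ cong length (List.filter-++ (ℤ._≟ c) (replicate a c) (replicate b (- c))) ⟩
    length (filter (ℤ._≟ c) (replicate a c) ++ filter (ℤ._≟ c) (replicate b (- c)))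
      ≡⟨ cong₂ (λ xs ys → length (xs ++ ys))
           (List.filter-all (ℤ._≟ c) (All.replicate⁺ a refl))
           (List.filter-none (ℤ._≟ c) (All.replicate⁺ b (c≢-c ∘ sym))) ⟩
    length (replicate a c ++ [])
      ≡⟨ cong length (List.++-identityʳ (replicate a c)) ⟩
    length (replicate a c)
      ≡⟨ List.length-replicate a ⟩
    a ∎
  a≡a′ : a ≡ a′
  a≡a′ = ≡.trans (sym (count a b)) (≡.trans (↭-length (filter-↭ (ℤ._≟ c) p)) (count a′ b′))

≢-neg : ∀ {c} → ∣ c ∣ ≢ 0 → c ≢ - c
≢-neg {+0}       c≢0 _ = c≢0 refl
≢-neg {+[1+ n ]} c≢0 ()
≢-neg { -[1+ n ]} c≢0 ()

abs-≡ : ∀ x y → ∣ x ∣ ≡ ∣ y ∣ → x ≡ y ⊎ x ≡ - y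
abs-≡ (+ m)    (+ n)    e = inj₁ (cong +_ e)
abs-≡ (+ m)    -[1+ n ] e = inj₂ (cong +_ e)
abs-≡ -[1+ m ] (+ n)    e = inj₂ (cong (-_ ∘ +_) e)
abs-≡ -[1+ m ] -[1+ n ] e = inj₁ (cong -[1+_] (ℕ.suc-injective e))

word-norm : ∀ {t t′ c c′} → ∣ c ∣ ≢ 0 → ∣ c′ ∣ ≡ ∣ c ∣ → word t′ c′ ↭ word t c → norm t′ ≡ norm t
word-norm {a , b} {a′ , b′} {c} {c′} c≢0 ∣c′∣≡∣c∣ p with abs-≡ c′ c ∣c′∣≡∣c∣
... | inj₁ refl = let e₁ , e₂ = word-injective (≢-neg {c} c≢0) p in cong₂ (λ x y → norm (x , y)) e₁ e₂
... | inj₂ refl = let e₁ , e₂ = word-injective (≢-neg {c} c≢0) (↭-trans (word-swap a′ b′ c) p) in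
  ≡.trans (norm-swap a′ b′) (cong₂ (λ x y → norm (x , y)) e₁ e₂)

-- Products of signed power sums

-- Singles out the functions of words that depend only on the monomial, that is, that respect
-- commutativity of the indeterminates.
Invariant : (List ℤ → ℤ) → Set
Invariant g = ∀ {w w′} → w ↭ w′ → g w ≡ g w′

Invariant-++ : ∀ {g} w → Invariant g → Invariant (g ∘ (w ++_))
Invariant-++ w inv p = inv (++⁺ˡ w p)

-- The coefficient extracted by g from the product of the p (a , b) over τ, where
-- p (a , b) = Σ xᵢᵃ x₋ᵢᵇ over i in C.
powerSums : List ℤ → List Type → (List ℤ → ℤ) → ℤ
powerSums C []      g = g []
powerSums C (t ∷ τ) g = ∑ (λ c → powerSums C τ (λ w → g (word t c ++ w))) C

module _ (C : List ℤ) where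

  powerSums-cong : ∀ τ {g g′} → (∀ w → g w ≡ g′ w) → powerSums C τ g ≡ powerSums C τ g′
  powerSums-cong []      h = h []
  powerSums-cong (t ∷ τ) h = ∑-cong C (λ {c} _ → powerSums-cong τ (λ w → h (word t c ++ w)))

  powerSums-↭ : ∀ {τ τ′ g} → Invariant g → τ ↭ τ′ → powerSums C τ g ≡ powerSums C τ′ g
  powerSums-↭ inv refl = refl
  powerSums-↭ inv (prep t p) = ∑-cong C (λ {c} _ → powerSums-↭ (Invariant-++ (word t c) inv) p)
  powerSums-↭ {τ = t ∷ t′ ∷ τ} {g = g} inv (swap .t .t′ p) = ≡.trans
    (∑-swap (λ c d → powerSums C τ (λ w → g (word t c ++ (word t′ d ++ w)))) C C)
    (∑-cong C (λ {d} _ → ∑-cong C (λ {c} _ → ≡.trans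
      (powerSums-cong τ (λ w → inv (exchange (word t c) (word t′ d) w)))
      (powerSums-↭ (Invariant-++ (word t c) (Invariant-++ (word t′ d) inv)) p))))
    where
    exchange : ∀ (xs ys zs : List ℤ) → xs ++ ys ++ zs ↭ ys ++ xs ++ zs
    exchange xs ys zs = begin
      xs ++ ys ++ zs   ≡⟨ List.++-assoc xs ys zs ⟨
      (xs ++ ys) ++ zs ↭⟨ ++⁺ʳ zs (++-comm xs ys) ⟩
      (ys ++ xs) ++ zs ≡⟨ List.++-assoc ys xs zs ⟩
      ys ++ xs ++ zs   ∎
      where open PermutationReasoning
  powerSums-↭ inv (trans p q) = ≡.trans (powerSums-↭ inv p) (powerSums-↭ inv q)

  module _ (C! : Unique C) (C-neg : ∀ {c} → c ∈ C → - c ∈ C) where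

    map-neg-↭ : map -_ C ↭ C
    map-neg-↭ = ∼bag⇒↭ (unique∧set⇒bag (Unique.map⁺ ℤ.neg-injective C!) C! (mk⇔ fwd bwd))
      where
      fwd : ∀ {x} → x ∈ map -_ C → x ∈ C
      fwd x∈ with ∈-map⁻ -_ x∈
      ... | c , c∈ , refl = C-neg c∈
      bwd : ∀ {x} → x ∈ C → x ∈ map -_ C
      bwd x∈ = subst (_∈ map -_ C) (ℤ.neg-involutive _) (∈-map⁺ -_ (C-neg x∈))

    powerSums-norm : ∀ t τ {g} → Invariant g → powerSums C (t ∷ τ) g ≡ powerSums C (norm t ∷ τ) g
    powerSums-norm (a , b) τ {g} inv with norm-cases a b
    ... | inj₁ e = cong (λ t → powerSums C (t ∷ τ) g) (sym e)
    ... | inj₂ e = ≡.trans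
      (≡.trans (sym (∑-↭ H map-neg-↭)) (≡.trans (∑-map H -_ C)
        (∑-cong C (λ {c} _ → powerSums-cong τ (λ w → inv (++⁺ʳ w (↭-sym (word-swap a b c))))))))
      (cong (λ t → powerSums C (t ∷ τ) g) (sym e))
      where
      H : ℤ → ℤ
      H c = powerSums C τ (λ w → g (word (a , b) c ++ w))

    spreads≡powerSums : ∀ us {g} → Invariant g → spreads C us g ≡ powerSums C (map kind us) g
    spreads≡powerSums []       inv = refl
    spreads≡powerSums (u ∷ us) inv = ≡.trans
      (∑-cong C (λ {c} _ → ≡.trans (spreads≡powerSums us (Invariant-++ (spread u c) inv))
        (powerSums-cong (map kind us) (λ w → inv (++⁺ʳ w (spread↭word u c))))))
      (powerSums-norm (ty u) (map kind us) inv)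

-- One term in the expansion of a product of power sums: every factor contributes its summand at the
-- chosen color.
words : List (Type × ℤ) → List ℤ
words []            = []
words ((t , c) ∷ r) = word t c ++ words r

words-++ : ∀ r r′ → words (r ++ r′) ≡ words r ++ words r′
words-++ []            r′ = refl
words-++ ((t , c) ∷ r) r′ = ≡.trans (cong (word t c ++_) (words-++ r r′)) (sym (List.++-assoc (word t c) _ _))

words-shift : ∀ as {t c} bs → words (as ++ (t , c) ∷ bs) ↭ word t c ++ words (as ++ bs)
words-shift as {t} {c} bs = begin
  words (as ++ (t , c) ∷ bs)           ≡⟨ words-++ as _ ⟩
  words as ++ word t c ++ words bs     ≡⟨ List.++-assoc (words as) _ _ ⟨
  (words as ++ word t c) ++ words bs   ↭⟨ ++⁺ʳ (words bs) (++-comm (words as) (word t c)) ⟩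
  (word t c ++ words as) ++ words bs   ≡⟨ List.++-assoc (word t c) _ _ ⟩
  word t c ++ words as ++ words bs     ≡⟨ cong (word t c ++_) (words-++ as bs) ⟨
  word t c ++ words (as ++ bs)         ∎
  where open PermutationReasoning

∈-words⁻ : ∀ r {x} → x ∈ words r → ∃[ t ] ∃[ c ] (t , c) ∈ r × ∣ x ∣ ≡ ∣ c ∣
∈-words⁻ ((t , c) ∷ r) x∈ with ∈-++⁻ (word t c) x∈
... | inj₁ x∈ = t , c , here refl , ∈-word⁻ {proj₁ t} x∈
... | inj₂ x∈ with ∈-words⁻ r x∈
...   | t′ , c′ , ∈r , e = t′ , c′ , there ∈r , e

powerSums-≢0 : ∀ C τ {g} → powerSums C τ g ≢ 0ℤ → ∃[ r ] map proj₁ r ≡ τ × g (words r) ≢ 0ℤ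
powerSums-≢0 C []      ≢0 = [] , refl , ≢0
powerSums-≢0 C (t ∷ τ) ≢0 with ∑-≢0 _ C ≢0
... | c , _ , ≢0′ with powerSums-≢0 C τ ≢0′
...   | r , refl , ≢0″ = (t , c) ∷ r , refl , ≢0″

powerSums-nonneg : ∀ C τ {g} → (∀ w → 0ℤ ≤ℤ g w) → 0ℤ ≤ℤ powerSums C τ g
powerSums-nonneg C []      h = h []
powerSums-nonneg C (t ∷ τ) h = ∑-nonneg _ C (λ c → powerSums-nonneg C τ (λ w → h (word t c ++ w)))

powerSums-pos : ∀ C {g} r → (∀ w → 0ℤ ≤ℤ g w) → All (λ p → proj₂ p ∈ C) r → 0ℤ <ℤ g (words r) →
                0ℤ <ℤ powerSums C (map proj₁ r) g
powerSums-pos C []            h []         0<g = 0<g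
powerSums-pos C ((t , c) ∷ r) h (c∈C ∷ r⊆C) 0<g =
  ∑-pos _ (λ d → powerSums-nonneg C (map proj₁ r) (λ w → h (word t d ++ w))) c∈C
        (powerSums-pos C r (λ w → h (word t c ++ w)) r⊆C 0<g)

-- Leading monomials

++-cancelˡ-↭ : ∀ (xs : List A) {ys zs} → xs ++ ys ↭ xs ++ zs → ys ↭ zs
++-cancelˡ-↭ []       p = p
++-cancelˡ-↭ (x ∷ xs) p = ++-cancelˡ-↭ xs (drop-∷ p)

++-cancelʳ-↭ : ∀ {xs xs′} {ys ys′ : List A} → ys ↭ ys′ → xs ++ ys ↭ xs′ ++ ys′ → xs ↭ xs′
++-cancelʳ-↭ {xs = xs} {xs′} {ys} {ys′} q p = ++-cancelˡ-↭ ys′ (begin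
  ys′ ++ xs  ↭⟨ ++⁺ʳ xs q ⟨
  ys ++ xs   ↭⟨ ++-comm ys xs ⟩
  xs ++ ys   ↭⟨ p ⟩
  xs′ ++ ys′ ↭⟨ ++-comm xs′ ys′ ⟩
  ys′ ++ xs′ ∎)
  where open PermutationReasoning

Nonempty : Type → Set
Nonempty t = 0 < proj₁ t

-- Distinct nonzero absolute values mean that no two factors share an indeterminate, so the factors
-- can be read off from the monomial.
record Rainbow (r : List (Type × ℤ)) : Set where
  constructor rainbow
  field
    nonempty : All (Nonempty ∘ proj₁) r
    nonzero  : All (λ p → ∣ proj₂ p ∣ ≢ 0) r
    distinct : AllPairs (λ p q → ∣ proj₂ p ∣ ≢ ∣ proj₂ q ∣) r

head∈words : ∀ {t c} r → Nonempty t → c ∈ words ((t , c) ∷ r)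
head∈words {suc a , b} r _ = here refl

filter-words : ∀ k r → filter (λ x → ¬? (∣ x ∣ ℕ.≟ k)) (words r) ≡ words (filter (λ p → ¬? (∣ proj₂ p ∣ ℕ.≟ k)) r)
filter-words k [] = refl
filter-words k ((t , c) ∷ r) = ≡.trans (List.filter-++ away? (word t c) (words r)) (cases (∣ c ∣ ℕ.≟ k))
  where
  away?  = λ (x : ℤ) → ¬? (∣ x ∣ ℕ.≟ k)
  other? = λ (p : Type × ℤ) → ¬? (∣ proj₂ p ∣ ℕ.≟ k)
  cases : Dec (∣ c ∣ ≡ k) → filter away? (word t c) ++ filter away? (words r) ≡ words (filter other? ((t , c) ∷ r))
  cases (yes ∣c∣≡k) = ≡.trans
    (cong₂ _++_ (List.filter-none away? {word t c} (All.tabulate (λ x∈ x≢ → x≢ (≡.trans (∈-word⁻ {proj₁ t} x∈) ∣c∣≡k))))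
                (filter-words k r))
    (cong words (sym (List.filter-reject other? {t , c} {r} (λ ne → ne ∣c∣≡k))))
  cases (no ∣c∣≢k) = ≡.trans
    (cong₂ _++_ (List.filter-all away? {word t c} (All.tabulate (λ x∈ e → ∣c∣≢k (≡.trans (sym (∈-word⁻ {proj₁ t} x∈)) e))))
                (filter-words k r))
    (cong words (sym (List.filter-accept other? {t , c} {r} ∣c∣≢k)))

-- Each factor of `r` owns an absolute value, which some factor of `r′` must supply. Discarding
-- everything of that absolute value on both sides leaves an instance for the induction; as `r′` has
-- no factors to spare, only one was discarded from it, and the two discarded words agree.
rainbow-determines : ∀ {r r′} → Rainbow r → length r′ ≤ length r → words r′ ↭ words r →
                     map (norm ∘ proj₁) r′ ↭ map (norm ∘ proj₁) r
rainbow-determines {[]}          {[]} _ _ _ = ↭-refl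
rainbow-determines {(t , c) ∷ r} {r′} (rainbow (t≢0 ∷ r≢0) (c≢0 ∷ nz) (c∉r ∷ dist)) r′≤ p
  with ∈-words⁻ r′ (∈-resp-↭ (↭-sym p) (head∈words r t≢0))
... | t′ , c′ , ∈r′ , ∣c∣≡∣c′∣ with ∈-∃++ ∈r′
...   | as , bs , refl = begin
  map (norm ∘ proj₁) (as ++ (t′ , c′) ∷ bs)    ↭⟨ ↭.map⁺ (norm ∘ proj₁) (shift _ as bs) ⟩
  norm t′ ∷ map (norm ∘ proj₁) r″              ≡⟨ cong₂ (λ x y → x ∷ map (norm ∘ proj₁) y) same (sym kept) ⟩
  norm t ∷ map (norm ∘ proj₁) (filter other? r″) ↭⟨ prep _ ih ⟩
  norm t ∷ map (norm ∘ proj₁) r                ∎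
  where
  open PermutationReasoning
  r″ = as ++ bs
  k = ∣ c ∣
  other? = λ (p : Type × ℤ) → ¬? (∣ proj₂ p ∣ ℕ.≟ k)
  away? = λ (x : ℤ) → ¬? (∣ x ∣ ℕ.≟ k)
  p′ : word t′ c′ ++ words r″ ↭ word t c ++ words r
  p′ = ↭-trans (↭-sym (words-shift as bs)) p
  strip : ∀ t c r → ∣ c ∣ ≡ k → filter away? (word t c ++ words r) ≡ words (filter other? r)
  strip t c r e = ≡.trans (filter-words k ((t , c) ∷ r)) (cong words (List.filter-reject other? {t , c} {r} (λ ne → ne e)))
  r-kept : filter other? r ≡ r
  r-kept = List.filter-all other? (All.map (λ ne e → ne (sym e)) c∉r)
  p″ : words (filter other? r″) ↭ words r
  p″ = begin
    words (filter other? r″)                  ≡⟨ strip t′ c′ r″ (sym ∣c∣≡∣c′∣) ⟨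
    filter away? (word t′ c′ ++ words r″)     ↭⟨ filter-↭ away? p′ ⟩
    filter away? (word t c ++ words r)        ≡⟨ strip t c r refl ⟩
    words (filter other? r)                   ≡⟨ cong words r-kept ⟩
    words r                                   ∎
  r″≤r : length r″ ≤ length r
  r″≤r = s≤s⁻¹ (subst (_≤ suc (length r)) (↭-length (shift (t′ , c′) as bs)) r′≤)
  ih : map (norm ∘ proj₁) (filter other? r″) ↭ map (norm ∘ proj₁) r
  ih = rainbow-determines (rainbow r≢0 nz dist) (ℕ.≤-trans (List.length-filter other? r″) r″≤r) p″
  -- By `ih` the filtered list has as many factors as `r`, hence at least as many as `r″`: no second
  -- factor of `r′` had absolute value `k`.
  kept : filter other? r″ ≡ r″
  kept = List.filter-complete other? (ℕ.≤-antisym (List.length-filter other? r″)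
    (ℕ.≤-trans r″≤r (ℕ.≤-reflexive (sym (≡.trans (sym (List.length-map _ (filter other? r″)))
      (≡.trans (↭-length ih) (List.length-map _ r)))))))
  same : norm t′ ≡ norm t
  same = word-norm {t} {t′} c≢0 (sym ∣c∣≡∣c′∣) (++-cancelʳ-↭ (subst (λ z → words z ↭ words r) kept p″) p′)

label : ℕ → List Type → List (Type × ℤ)
label k []      = []
label k (t ∷ τ) = (t , +[1+ k ]) ∷ label (suc k) τ

label-proj₁ : ∀ k τ → map proj₁ (label k τ) ≡ τ
label-proj₁ k []      = refl
label-proj₁ k (t ∷ τ) = cong (t ∷_) (label-proj₁ (suc k) τ)

label-bound : ∀ k τ → All (λ p → k < ∣ proj₂ p ∣) (label k τ)
label-bound k []      = []
label-bound k (t ∷ τ) = ℕ.≤-refl ∷ All.map ℕ.<⇒≤ (label-bound (suc k) τ)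

label-distinct : ∀ k τ → AllPairs (λ p q → ∣ proj₂ p ∣ ≢ ∣ proj₂ q ∣) (label k τ)
label-distinct k []      = []
label-distinct k (t ∷ τ) = All.map ℕ.<⇒≢ (label-bound (suc k) τ) ∷ label-distinct (suc k) τ

label-rainbow : ∀ {τ} → All Nonempty τ → Rainbow (label 0 τ)
label-rainbow {τ} ne = rainbow (nonempty 0 ne) (All.map (λ 0<n → ℕ.<⇒≢ 0<n ∘ sym) (label-bound 0 τ)) (label-distinct 0 τ)
  where
  nonempty : ∀ k {τ} → All Nonempty τ → All (Nonempty ∘ proj₁) (label k τ)
  nonempty k []        = []
  nonempty k (ne ∷ nes) = ne ∷ nonempty (suc k) nes

-- The factors receive the colors 1, 2, 3, and so on, which makes the term a rainbow.
leading : List Type → Monomial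
leading τ = words (label 0 τ)

rainbow-colors : ∀ {r} → All (Nonempty ∘ proj₁) r → All (λ p → proj₂ p ∈ words r) r
rainbow-colors {[]}          []         = []
rainbow-colors {(t , c) ∷ r} (ne ∷ nes) = head∈words r ne ∷ All.map (∈-++⁺ʳ (word t c)) (rainbow-colors nes)

coeff : List Type → Monomial → ℤ
coeff τ m = powerSums (palette m) τ (λ w → ⟦ w ↭? m ⟧)

↭?-invariant : ∀ m → Invariant (λ w → ⟦ w ↭? m ⟧)
↭?-invariant m {w} {w′} p = ⟦⟧-⇔ (w ↭? m) (w′ ↭? m) (mk⇔ (↭-trans (↭-sym p)) (↭-trans p))

coeff-nonneg : ∀ τ m → 0ℤ ≤ℤ coeff τ m
coeff-nonneg τ m = powerSums-nonneg (palette m) τ (λ w → ⟦⟧-nonneg (w ↭? m))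

coeff-leading-pos : ∀ {τ} → All Nonempty τ → 0ℤ <ℤ coeff τ (leading τ)
coeff-leading-pos {τ} ne = subst (λ z → 0ℤ <ℤ coeff z m) (label-proj₁ 0 τ)
  (powerSums-pos (palette m) (label 0 τ) (λ w → ⟦⟧-nonneg (w ↭? m))
    (All.map ∈-palette⁺ (rainbow-colors (Rainbow.nonempty (label-rainbow ne))))
    (subst (0ℤ <ℤ_) (sym (⟦⟧-yes (m ↭? m) ↭-refl)) (+<+ (s≤s z≤n))))
  where m = leading τ

Normal : Type → Set
Normal t = Nonempty t × norm t ≡ t

map-norm : ∀ {τ} → All Normal τ → map norm τ ≡ τ
map-norm []              = refl
map-norm ((_ , e) ∷ nes) = cong₂ _∷_ e (map-norm nes)

-- Triangularity with respect to the number of factors: merging factors of `τ′` onto one absolute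
-- value would leave too few of them to reach the colors of `leading τ`.
coeff-leading-≢0 : ∀ {τ τ′} → All Normal τ → All Normal τ′ → length τ′ ≤ length τ →
                   coeff τ′ (leading τ) ≢ 0ℤ → τ′ ↭ τ
coeff-leading-≢0 {τ} {τ′} N N′ τ′≤τ ≢0 with powerSums-≢0 (palette (leading τ)) τ′ ≢0
... | r , refl , ≢0′ with words r ↭? leading τ
...   | no  _ = contradiction refl ≢0′
...   | yes p = subst₂ _↭_ (normal r refl N′) (normal (label 0 τ) (label-proj₁ 0 τ) N)
  (rainbow-determines (label-rainbow (All.map proj₁ N))
    (subst₂ _≤_ (List.length-map proj₁ r)
      (≡.trans (cong length (sym (label-proj₁ 0 τ))) (List.length-map proj₁ (label 0 τ))) τ′≤τ) p)
  where
  normal : ∀ r {τ} → map proj₁ r ≡ τ → All Normal τ → map (norm ∘ proj₁) r ≡ τ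
  normal r refl N = ≡.trans (List.map-∘ r) (map-norm N)

-- Linear independence of the products of signed power sums

alternatingSum : List (List Type) → Monomial → ℤ
alternatingSum L m = ∑ (λ τ → sgn (length τ) ⊛ coeff τ m) L

sgn≢0 : ∀ n → sgn n ≢ 0ℤ
sgn≢0 (suc n) e = sgn≢0 n (ℤ.neg-injective e)

longest : (L : List (List A)) → L ≡ [] ⊎ ∃[ τ ] τ ∈ L × (∀ {τ′} → τ′ ∈ L → length τ′ ≤ length τ)
longest []      = inj₁ refl
longest (τ ∷ L) with longest L
... | inj₁ refl = inj₂ (τ , here refl , λ { (here refl) → ℕ.≤-refl })
... | inj₂ (τ⁺ , τ⁺∈ , max) with ℕ.≤-total (length τ) (length τ⁺)
...   | inj₁ ≤ = inj₂ (τ⁺ , there τ⁺∈ , λ { (here refl) → ≤ ; (there ∈L) → max ∈L })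
...   | inj₂ ≥ = inj₂ (τ , here refl , λ { (here refl) → ℕ.≤-refl ; (there ∈L) → ℕ.≤-trans (max ∈L) ≥ })

-- By the choice of `τ` as a longest product, everything in `L` contributing to its leading monomial
-- is a permutation of `τ`. Such products have equal signs and nonnegative coefficients, so the
-- total is nonzero and `L′` must contribute as well.
partner : ∀ {L L′ τ} → All (All Normal) L → All (All Normal) L′ → (∀ m → alternatingSum L m ≡ alternatingSum L′ m) →
          τ ∈ L → (∀ {τ′} → τ′ ∈ L ++ L′ → length τ′ ≤ length τ) →
          ∃[ τ′ ] τ′ ∈ L′ × τ ↭ τ′
partner {L} {L′} {τ} N N′ eq τ∈L max with ∑-≢0 _ L′ (λ e → nonzero (≡.trans (eq m) e))
  where
  m = leading τ
  Nτ = All.lookup N τ∈L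
  same-sign : ∀ {τ′} → τ′ ∈ L → sgn (length τ′) ⊛ coeff τ′ m ≡ sgn (length τ) ⊛ coeff τ′ m
  same-sign {τ′} τ′∈L with coeff τ′ m ℤ.≟ 0ℤ
  ... | yes e = ≡.trans (cong (sgn (length τ′) ⊛_) e) (≡.trans (ℤ.*-zeroʳ (sgn (length τ′)))
                  (sym (≡.trans (cong (sgn (length τ) ⊛_) e) (ℤ.*-zeroʳ (sgn (length τ))))))
  ... | no ≢0 = cong (λ n → sgn n ⊛ coeff τ′ m)
                  (↭-length (coeff-leading-≢0 Nτ (All.lookup N τ′∈L) (max (∈-++⁺ˡ τ′∈L)) ≢0))
  nonzero : alternatingSum L m ≢ 0ℤ
  nonzero e with ℤ.i*j≡0⇒i≡0∨j≡0 (sgn (length τ))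
                   (≡.trans (sym (≡.trans (∑-cong L same-sign) (∑-*ˡ (sgn (length τ)) _ L))) e)
  ... | inj₁ s≡0 = sgn≢0 (length τ) s≡0
  ... | inj₂ Σ≡0 = ℤ.<⇒≢ (∑-pos _ (λ τ′ → coeff-nonneg τ′ m) τ∈L (coeff-leading-pos (All.map proj₁ Nτ))) (sym Σ≡0)
... | τ′ , τ′∈L′ , ≢0 = τ′ , τ′∈L′ , ↭-sym (coeff-leading-≢0 (All.lookup N τ∈L) (All.lookup N′ τ′∈L′)
    (max (∈-++⁺ʳ L τ′∈L′)) (λ e → ≢0 (≡.trans (cong (sgn (length τ′) ⊛_) e) (ℤ.*-zeroʳ (sgn (length τ′))))))

infix 4 _⊑_
_⊑_ : List (List Type) → List (List Type) → Set
L ⊑ L′ = ∀ {τ} → τ ∈ L → ∃[ τ′ ] τ′ ∈ L′ × τ ↭ τ′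

⊑-insert : ∀ as {bs as′ bs′ τ τ′} → τ ↭ τ′ → as ++ bs ⊑ as′ ++ bs′ → as ++ τ ∷ bs ⊑ as′ ++ τ′ ∷ bs′
⊑-insert as {bs} {as′} {bs′} {τ} {τ′} p sub ∈L with ∈-resp-↭ (shift τ as bs) ∈L
... | here refl = τ′ , ∈-++⁺ʳ as′ (here refl) , p
... | there ∈L′ with sub ∈L′
...   | υ , υ∈ , q = υ , ∈-resp-↭ (↭-sym (shift τ′ as′ bs′)) (there υ∈) , q

alternatingSum-remove : ∀ as {bs as′ bs′ τ τ′} → τ ↭ τ′ →
  (∀ m → alternatingSum (as ++ τ ∷ bs) m ≡ alternatingSum (as′ ++ τ′ ∷ bs′) m) →
  ∀ m → alternatingSum (as ++ bs) m ≡ alternatingSum (as′ ++ bs′) m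
alternatingSum-remove as {bs} {as′} {bs′} {τ} {τ′} p eq m = ∙-cancelˡ ℤ.+-0-abelianGroup (f τ) _ _ (begin
  f τ ⊕ ∑ f (as ++ bs)    ≡⟨ ∑-↭ f (shift τ as bs) ⟨
  ∑ f (as ++ τ ∷ bs)      ≡⟨ eq m ⟩
  ∑ f (as′ ++ τ′ ∷ bs′)   ≡⟨ ∑-↭ f (shift τ′ as′ bs′) ⟩
  f τ′ ⊕ ∑ f (as′ ++ bs′) ≡⟨ cong (_⊕ ∑ f (as′ ++ bs′)) (cong₂ (λ n x → sgn n ⊛ x) (↭-length p)
                               (powerSums-↭ (palette m) (↭?-invariant m) p)) ⟨
  f τ ⊕ ∑ f (as′ ++ bs′)  ∎)
  where
  open ≡-Reasoning
  f : List Type → ℤ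
  f τ = sgn (length τ) ⊛ coeff τ m

-- A longest product on either side has a partner on the other. Removing the pair preserves the
-- equation, and the bound `n` on the length of `L` decreases.
independence : ∀ n {L L′} → length L ≤ n → All (All Normal) L → All (All Normal) L′ →
               (∀ m → alternatingSum L m ≡ alternatingSum L′ m) → L ⊑ L′ × L′ ⊑ L
independence n {L} {L′} L≤n N N′ eq with longest (L ++ L′)
... | inj₁ e = (λ ∈L → contradiction (subst (_ ∈_) e (∈-++⁺ˡ ∈L)) (λ ()))
             , (λ ∈L′ → contradiction (subst (_ ∈_) e (∈-++⁺ʳ L ∈L′)) (λ ()))
... | inj₂ (τ , τ∈ , max) with pair (∈-++⁻ L τ∈)
  where
  pair : τ ∈ L ⊎ τ ∈ L′ → ∃[ υ ] ∃[ υ′ ] υ ∈ L × υ′ ∈ L′ × υ ↭ υ′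
  pair (inj₁ τ∈L) = let τ′ , τ′∈ , p = partner N N′ eq τ∈L max in τ , τ′ , τ∈L , τ′∈ , p
  pair (inj₂ τ∈L′) =
    let τ′ , τ′∈ , p = partner N′ N (sym ∘ eq) τ∈L′ (max ∘ ∈-resp-↭ (++-comm L′ L)) in
    τ′ , τ , τ′∈ , τ∈L′ , ↭-sym p
... | υ , υ′ , υ∈ , υ′∈ , p with ∈-∃++ υ∈ | ∈-∃++ υ′∈ | n
...   | as , bs , refl | as′ , bs′ , refl | zero =
  contradiction (ℕ.≤-trans (ℕ.≤-reflexive (sym (↭-length (shift υ as bs)))) L≤n) (λ ())
...   | as , bs , refl | as′ , bs′ , refl | suc n′ =
  let ⊑₁ , ⊑₂ = independence n′
        (s≤s⁻¹ (ℕ.≤-trans (ℕ.≤-reflexive (sym (↭-length (shift υ as bs)))) L≤n))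
        (remove as N) (remove as′ N′) (alternatingSum-remove as {as′ = as′} p eq)
  in ⊑-insert as p ⊑₁ , ⊑-insert as′ (↭-sym p) ⊑₂
  where
  remove : ∀ as {υ bs} → All (All Normal) (as ++ υ ∷ bs) → All (All Normal) (as ++ bs)
  remove as N with All.++⁻ as N
  ... | Nas , _ ∷ Nbs = All.++⁺ Nas Nbs

-- From `X` to the kinds of segments

kinds : List Sign → List (List Type)
kinds s = map (λ (u , us) → map kind (u ∷ us)) (segmentations s)

ty-nonempty : ∀ u → Nonempty (ty u)
ty-nonempty []        = s≤s z≤n
ty-nonempty (pos ∷ u) = s≤s z≤n
ty-nonempty (neg ∷ u) = s≤s z≤n

kind-normal : ∀ u → Normal (kind u)
kind-normal u = ℕ.<-≤-trans (ty-nonempty u) (ℕ.m≤m⊔n (proj₁ (ty u)) (proj₂ (ty u))) , norm-idem (ty u)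

kinds-normal : ∀ s → All (All Normal) (kinds s)
kinds-normal s = All.map⁺ (All.universal (λ (u , us) → All.map⁺ (All.universal kind-normal (u ∷ us))) (segmentations s))

-- The minus sign arises because a product has one factor more than `length us`: the first segment
-- counts too.
X-kinds : ∀ s m → + X (signedPath s) m ≡ - sgn (length s) ⊛ alternatingSum (kinds s) m
X-kinds s m = ≡.trans (X-signedPath s m) (begin
  e ⊛ ∑ (λ (u , us) → sgn (length us) ⊛ spreads (palette m) (u ∷ us) (λ w → ⟦ w ↭? m ⟧)) S
    ≡⟨ cong (e ⊛_) (∑-cong S (λ {(u , us)} _ → ≡.trans
         (cong₂ _⊛_ (≡.trans (cong sgn (sym (List.length-map kind us))) (sym (ℤ.neg-involutive _)))
           (spreads≡powerSums (palette m) (palette-unique m) (palette-neg m) (u ∷ us) (↭?-invariant m)))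
         (negate (- sgn (length (map kind us))) _))) ⟩
  e ⊛ ∑ (λ (u , us) → - 1ℤ ⊛ (sgn (length (map kind (u ∷ us))) ⊛ coeff (map kind (u ∷ us)) m)) S
    ≡⟨ cong (e ⊛_) (≡.trans (∑-*ˡ (- 1ℤ) _ S) (cong (- 1ℤ ⊛_) (sym (∑-map _ _ S)))) ⟩
  e ⊛ (- 1ℤ ⊛ alternatingSum (kinds s) m)
    ≡⟨ arith e _ ⟩
  - e ⊛ alternatingSum (kinds s) m ∎)
  where
  open ≡-Reasoning
  e = sgn (length s)
  S = segmentations s
  negate : ∀ a b → - a ⊛ b ≡ - 1ℤ ⊛ (a ⊛ b)
  negate = solve-∀
  arith : ∀ a b → a ⊛ (- 1ℤ ⊛ b) ≡ - a ⊛ b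
  arith = solve-∀

X⇒kinds : ∀ s s′ → X (signedPath s) ≐ X (signedPath s′) → kinds s ⊑ kinds s′
X⇒kinds s s′ X≐ = proj₁ (independence (length (kinds s)) ℕ.≤-refl (kinds-normal s) (kinds-normal s′)
  (λ m → cancel (- sgn (length s)) (λ e → sgn≢0 (length s) (ℤ.neg-injective e)) (begin
    - sgn (length s) ⊛ alternatingSum (kinds s) m   ≡⟨ X-kinds s m ⟨
    + X (signedPath s) m                            ≡⟨ cong +_ (X≐ m) ⟩
    + X (signedPath s′) m                           ≡⟨ X-kinds s′ m ⟩
    -- Both global signs agree since the two paths have equally many vertices, so they can be
    -- cancelled.
    - sgn (length s′) ⊛ alternatingSum (kinds s′) m ≡⟨ cong (λ n → - sgn n ⊛ alternatingSum (kinds s′) m) (X-length s s′ X≐) ⟨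
    - sgn (length s) ⊛ alternatingSum (kinds s′) m  ∎)))
  where
  open ≡-Reasoning
  cancel : ∀ k {a b} → k ≢ 0ℤ → k ⊛ a ≡ k ⊛ b → a ≡ b
  cancel k k≢0 = ℤ.*-cancelˡ-≡ k _ _ {{≢-nonZero k≢0}}

-- Segmentations of a path

-- The relational form of `segmentations`, which later arguments analyze by pattern matching.
data Segs : List Sign → List (List Sign) → Set where
  end  : Segs [] [ [] ]
  cut  : Segs s us → Segs (σ ∷ s) ([] ∷ us)
  join : Segs s (u ∷ us) → Segs (σ ∷ s) ((σ ∷ u) ∷ us)

∈-segmentations⁺ : Segs s (u ∷ us) → (u , us) ∈ segmentations s
∈-segmentations⁺ end = here refl
∈-segmentations⁺ (cut {us = u ∷ us} S) = ∈-++⁺ˡ (∈-map⁺ _ (∈-segmentations⁺ S))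
∈-segmentations⁺ {s = σ ∷ s} (join S) =
  ∈-++⁺ʳ (map (λ (u , us) → [] , u ∷ us) (segmentations s)) (∈-map⁺ _ (∈-segmentations⁺ S))

∈-segmentations⁻ : ∀ s → (u , us) ∈ segmentations s → Segs s (u ∷ us)
∈-segmentations⁻ []      (here refl) = end
∈-segmentations⁻ (σ ∷ s) ∈S with ∈-++⁻ (map (λ (u , us) → [] , u ∷ us) (segmentations s)) ∈S
... | inj₁ ∈cut with ∈-map⁻ _ ∈cut
...   | _ , ∈S′ , refl = cut (∈-segmentations⁻ s ∈S′)
∈-segmentations⁻ (σ ∷ s) ∈S | inj₂ ∈join with ∈-map⁻ _ ∈join
...   | _ , ∈S′ , refl = join (∈-segmentations⁻ s ∈S′)

infix 4 _≼_
_≼_ : List Sign → List Sign → Set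
s ≼ s′ = ∀ {us} → Segs s us → ∃[ us′ ] Segs s′ us′ × map kind us ↭ map kind us′

kinds⇒≼ : ∀ s s′ → kinds s ⊑ kinds s′ → s ≼ s′
kinds⇒≼ s s′ sub {u ∷ us} S with sub (∈-map⁺ _ (∈-segmentations⁺ S))
... | _ , ∈kinds , p with ∈-map⁻ _ ∈kinds
...   | (u′ , us′) , ∈S′ , refl = u′ ∷ us′ , ∈-segmentations⁻ s′ ∈S′ , p

X⇒≼ : ∀ s s′ → X (signedPath s) ≐ X (signedPath s′) → s ≼ s′
X⇒≼ s s′ X≐ = kinds⇒≼ s s′ (X⇒kinds s s′ X≐)

segs-whole : ∀ s → Segs s [ s ]
segs-whole []      = end
segs-whole (σ ∷ s) = join (segs-whole s)

segs-whole⁻ : Segs s [ u ] → u ≡ s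
segs-whole⁻ end      = refl
segs-whole⁻ (join S) = cong (_ ∷_) (segs-whole⁻ S)

segs-++ : ∀ u → Segs s us → Segs (u ++ σ ∷ s) (u ∷ us)
segs-++ []      S = cut S
segs-++ (σ ∷ u) S = join (segs-++ u S)

segs-∷ʳ-cut : Segs s us → Segs (s ∷ʳ σ) (us ∷ʳ [])
segs-∷ʳ-cut end      = cut end
segs-∷ʳ-cut (cut S)  = cut (segs-∷ʳ-cut S)
segs-∷ʳ-cut (join S) = join (segs-∷ʳ-cut S)

segs-∷ʳ-join : ∀ us → Segs s (us ∷ʳ u) → Segs (s ∷ʳ σ) (us ∷ʳ (u ∷ʳ σ))
segs-∷ʳ-join {s = []} (_ ∷ [])     ()
segs-∷ʳ-join {s = []} (_ ∷ _ ∷ _)  ()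
segs-∷ʳ-join []            end      = join end
segs-∷ʳ-join []            (join S) = join (segs-∷ʳ-join [] S)
segs-∷ʳ-join (.[] ∷ us)    (cut S)  = cut (segs-∷ʳ-join us S)
segs-∷ʳ-join ((_ ∷ u) ∷ us) (join S) = join (segs-∷ʳ-join (u ∷ us) S)

reverseSegs : List (List Sign) → List (List Sign)
reverseSegs = reverse ∘ map reverse

segs-reverse : Segs s us → Segs (reverse s) (reverseSegs us)
segs-reverse end = end
segs-reverse {s = σ ∷ s} (cut {us = us} S) =
  subst₂ Segs (sym (List.unfold-reverse σ s)) (sym (List.unfold-reverse [] (map reverse us)))
    (segs-∷ʳ-cut (segs-reverse S))
segs-reverse {s = σ ∷ s} (join {u = u} {us = us} S) =
  subst₂ Segs (sym (List.unfold-reverse σ s))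
    (≡.trans (cong (reverseSegs us ∷ʳ_) (sym (List.unfold-reverse σ u)))
             (sym (List.unfold-reverse (reverse (σ ∷ u)) (map reverse us))))
    (segs-∷ʳ-join (reverseSegs us)
      (subst (Segs (reverse s)) (List.unfold-reverse (reverse u) (map reverse us)) (segs-reverse S)))

-- Kinds of segments

-- Tells whether the last vertex of a segment lies in the switching class of the first one.
total : List Sign → Sign
total []      = pos
total (σ ∷ u) = σ Sign.* total u

bump flip : Sign → Type → Type
bump pos (a , b) = suc a , b
bump neg (a , b) = a , suc b
flip pos t       = t
flip neg (a , b) = b , a

ty-∷ʳ : ∀ u → ty (u ∷ʳ σ) ≡ bump (total u Sign.* σ) (ty u)
ty-∷ʳ {pos} []        = refl
ty-∷ʳ {neg} []        = refl
ty-∷ʳ {σ}   (pos ∷ u) = ≡.trans (cong (bump pos) (ty-∷ʳ u)) (commute (total u Sign.* σ) (ty u))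
  where
  commute : ∀ ρ t → bump pos (bump ρ t) ≡ bump ρ (bump pos t)
  commute pos t = refl
  commute neg t = refl
ty-∷ʳ {σ}   (neg ∷ u) = ≡.trans (cong (bump pos ∘ flip neg) (ty-∷ʳ u)) (commute (total u) σ (ty u))
  where
  commute : ∀ τ σ t → bump pos (flip neg (bump (τ Sign.* σ) t)) ≡
                      bump ((neg Sign.* τ) Sign.* σ) (bump pos (flip neg t))
  commute pos pos t = refl
  commute pos neg t = refl
  commute neg pos t = refl
  commute neg neg t = refl

-- `ty` lists the class of the first vertex first; reversal puts the last vertex in its place, so
-- the entries are exchanged exactly when the ends lie in different classes.
ty-reverse : ∀ u → ty (reverse u) ≡ flip (total u) (ty u)
ty-reverse []      = refl
ty-reverse (σ ∷ u) = begin
  ty (reverse (σ ∷ u))                                     ≡⟨ cong ty (List.unfold-reverse σ u) ⟩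
  ty (reverse u ∷ʳ σ)                                      ≡⟨ ty-∷ʳ (reverse u) ⟩
  bump (total (reverse u) Sign.* σ) (ty (reverse u))       ≡⟨ cong₂ (λ τ t → bump (τ Sign.* σ) t) (total-reverse u) (ty-reverse u) ⟩
  bump (total u Sign.* σ) (flip (total u) (ty u))          ≡⟨ step σ (total u) ⟩
  flip (total (σ ∷ u)) (ty (σ ∷ u))                        ∎
  where
  open ≡-Reasoning
  total-∷ʳ : ∀ σ u → total (u ∷ʳ σ) ≡ σ Sign.* total u
  total-∷ʳ pos []      = refl
  total-∷ʳ neg []      = refl
  total-∷ʳ σ   (ρ ∷ u) = ≡.trans (cong (ρ Sign.*_) (total-∷ʳ σ u)) (exchange ρ σ (total u))
    where
    exchange : ∀ ρ σ τ → ρ Sign.* (σ Sign.* τ) ≡ σ Sign.* (ρ Sign.* τ)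
    exchange pos σ   τ = refl
    exchange neg pos τ = refl
    exchange neg neg τ = refl
  total-reverse : ∀ u → total (reverse u) ≡ total u
  total-reverse []      = refl
  total-reverse (σ ∷ u) = ≡.trans (cong total (List.unfold-reverse σ u))
    (≡.trans (total-∷ʳ σ (reverse u)) (cong (σ Sign.*_) (total-reverse u)))
  step : ∀ σ τ → bump (τ Sign.* σ) (flip τ (ty u)) ≡ flip (σ Sign.* τ) (ty (σ ∷ u))
  step pos pos = refl
  step pos neg = refl
  step neg pos = refl
  step neg neg = refl

kind-reverse : ∀ u → kind (reverse u) ≡ kind u
kind-reverse u = ≡.trans (cong norm (ty-reverse u)) (norm-flip (total u) (ty u))
  where
  norm-flip : ∀ τ t → norm (flip τ t) ≡ norm t
  norm-flip pos t       = refl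
  norm-flip neg (a , b) = norm-swap b a

map-kind-reverse : ∀ us → map kind (map reverse us) ≡ map kind us
map-kind-reverse us = ≡.trans (sym (List.map-∘ us)) (List.map-cong kind-reverse us)

kinds-reverse : ∀ us → map kind (reverseSegs us) ↭ map kind us
kinds-reverse us = begin
  map kind (reverse (map reverse us)) ≡⟨ List.reverse-map kind (map reverse us) ⟩
  reverse (map kind (map reverse us)) ↭⟨ ↭-reverse _ ⟩
  map kind (map reverse us)           ≡⟨ map-kind-reverse us ⟩
  map kind us                         ∎
  where open PermutationReasoning

pure : ℕ → Type
pure k = k , 0

Pure : List Sign → Set
Pure u = proj₂ (kind u) ≡ 0

run : ℕ → List Sign
run n = replicate n pos

ty-run : ∀ n → ty (run n) ≡ (suc n , 0)
ty-run zero    = refl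
ty-run (suc n) = cong (bump pos) (ty-run n)

kind-run : ∀ n → kind (run n) ≡ pure (suc n)
kind-run n = cong norm (ty-run n)

-- The first vertex always counts towards the first entry of `ty`, so a vanishing minimum means that
-- the second entry vanishes. A negative edge would put vertices in both classes.
pure⇒run : ∀ u → Pure u → ∃[ n ] u ≡ run n
pure⇒run u e = unmixed u (zero-part (ty u) (ty-nonempty u) e)
  where
  zero-part : ∀ t → 0 < proj₁ t → proj₁ t ⊓ proj₂ t ≡ 0 → proj₂ t ≡ 0
  zero-part (suc a , zero) _ _ = refl
  unmixed : ∀ u → proj₂ (ty u) ≡ 0 → ∃[ n ] u ≡ run n
  unmixed []        _ = 0 , refl
  unmixed (pos ∷ u) e = let n , u≡ = unmixed u e in suc n , cong (pos ∷_) u≡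
  unmixed (neg ∷ u) e = contradiction (sym e) (ℕ.<⇒≢ (ty-nonempty u))

neg⇒mixed : neg ∈ u → ¬ Pure u
neg⇒mixed {u} neg∈u e with pure⇒run u e
... | n , refl with All.lookup (All.replicate⁺ {P = _≡ pos} n refl) neg∈u
...   | ()

-- Segmentations of a composition

signs : List ℕ → List Sign
signs []       = []
signs (a ∷ as) = pathSigns a as

block : ℕ → List Sign
block a = run (pred a)

kind-block : ∀ a → .{{_ : NonZero a}} → kind (block a) ≡ pure a
kind-block (suc a) = kind-run a

-- Unlike `signs []`, which is a path on one vertex, the empty list of parts here has no vertices
-- and no segments. This lets recursions continue until all parts are consumed.
data Cover : List ℕ → List (List Sign) → Set where
  none : Cover [] []
  some : ∀ {b bs} → Segs (pathSigns b bs) us → Cover (b ∷ bs) us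

pathSigns-suc : ∀ b bs → pathSigns (suc (suc b)) bs ≡ pos ∷ pathSigns (suc b) bs
pathSigns-suc b []       = refl
pathSigns-suc b (_ ∷ bs) = refl

cover-block : ∀ {b bs} → Cover bs us → Cover (b ∷ bs) (block b ∷ us)
cover-block {b = b} none     = some (segs-whole (block b))
cover-block {b = b} (some S) = some (segs-++ (block b) S)

cover-blocks : ∀ as {bs} → Cover bs us → Cover (as ++ bs) (map block as ++ us)
cover-blocks []       C = C
cover-blocks (a ∷ as) C = cover-block (cover-blocks as C)

-- A run cannot cross the negative edge after the first part: it either fills that part or leaves
-- `suc r` of its vertices.
run-step : ∀ b bs n → Segs (pathSigns (suc b) bs) (run n ∷ us) →
           (n ≡ b × Cover bs us) ⊎ ∃[ r ] b ≡ suc n + r × Cover (suc r ∷ bs) us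
run-step zero    []       zero    end      = inj₁ (refl , none)
run-step zero    []       (suc n) ()
run-step zero    (_ ∷ bs) zero    (cut S)  = inj₁ (refl , some S)
run-step zero    (_ ∷ bs) (suc n) ()
run-step (suc b) bs n S with pathSigns (suc (suc b)) bs | pathSigns-suc b bs
run-step (suc b) bs zero    (cut S)  | _ | refl = inj₂ (b , refl , some S)
run-step (suc b) bs (suc n) (join S) | _ | refl =
  Sum.map (λ (e , C) → cong suc e , C) (λ (r , e , C) → r , cong suc e , C) (run-step b bs n S)

pure-step : ∀ {b bs} → .{{NonZero b}} → Cover (b ∷ bs) (u ∷ us) → Pure u →
            ∃[ n ] kind u ≡ pure (suc n) × ((suc n ≡ b × Cover bs us)
                                         ⊎ ∃[ r ] b ≡ suc n + suc r × Cover (suc r ∷ bs) us)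
pure-step {u = u} {b = suc b} {bs} (some S) Pu with pure⇒run u Pu
... | n , refl = n , kind-run n ,
  Sum.map (λ (e , C) → cong suc e , C)
          (λ (r , e , C) → r , cong suc (≡.trans e (sym (ℕ.+-suc n r))) , C)
          (run-step b bs n S)

-- Pure segments at the start exhaust the parts at a rate of at most one part per segment.
greedy : {Q : ℕ → Set} → (∀ {m n} → m ≤ n → Q n → Q m) → ∀ {rest cs} →
  (∀ {b bs} → .{{NonZero b}} → Q b → ¬ Cover (b ∷ bs ++ cs) rest) →
  ∀ bs vs → All NonZero bs → All Q bs → All Pure vs → Cover (bs ++ cs) (vs ++ rest) →
  length bs ≤ length vs × (length bs ≡ length vs → map kind vs ≡ map pure bs)
greedy down stop []       []       _ _ _ _ = z≤n , λ _ → refl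
greedy down stop []       (v ∷ vs) _ _ _ _ = z≤n , λ ()
-- A part is left over but the pure segments are spent; `stop` prevents `rest` from starting inside
-- a part satisfying `Q`.
greedy down stop (b ∷ bs) []       (b≢0 ∷ _) (Qb ∷ _) _ C =
  contradiction C (stop {{b≢0}} Qb)
greedy down stop (b ∷ bs) (v ∷ vs) (b≢0 ∷ nz) (Qb ∷ Qbs) (Pv ∷ Pvs) C
  with pure-step {{b≢0}} C Pv
... | n , kv , inj₁ (e , C′) =
  let le , eq = greedy down stop bs vs nz Qbs Pvs C′ in
  s≤s le , λ e′ → cong₂ _∷_ (≡.trans kv (cong pure e)) (eq (ℕ.suc-injective e′))
-- This segment is spent without finishing a part, so the lengths cannot agree. The remainder of the
-- part inherits `Q` because it is smaller.
... | n , kv , inj₂ (r , e , C′) =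
  let le , _ = greedy down stop (suc r ∷ bs) vs (_ ∷ nz)
                (down (subst (suc r ≤_) (sym e) (ℕ.m≤n+m (suc r) (suc n))) Qb ∷ Qbs) Pvs C′ in
  ℕ.m≤n⇒m≤1+n le , λ e′ → contradiction (sym (ℕ.suc-injective e′)) (ℕ.<⇒≢ le ∘ sym)

pure-injective : ∀ {as bs} → map pure as ↭ map pure bs → as ↭ bs
pure-injective {as} {bs} p = subst₂ _↭_ (unpure as) (unpure bs) (↭.map⁺ proj₁ p)
  where
  unpure : ∀ as → map proj₁ (map pure as) ≡ as
  unpure as = ≡.trans (sym (List.map-∘ as)) (List.map-id as)

all-pure : ∀ {τ} → map kind us ↭ map pure τ → All Pure us
all-pure {us = us} {τ = τ} p = All.tabulate λ u∈ → go (∈-map⁻ pure (∈-resp-↭ p (∈-map⁺ kind u∈)))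
  where
  go : ∀ {k : Type} → ∃[ a ] a ∈ τ × k ≡ pure a → proj₂ k ≡ 0
  go (_ , _ , refl) = refl

kinds-blocks : ∀ {as} → All NonZero as → map kind (map block as) ≡ map pure as
kinds-blocks []                = refl
kinds-blocks {a ∷ as} (nz ∷ nzs) = cong₂ _∷_ (kind-block a {{nz}}) (kinds-blocks nzs)

cover⁻ : ∀ {a as} → Cover (a ∷ as) us → Segs (pathSigns a as) us
cover⁻ (some S) = S

infix 4 _⊴_
_⊴_ : List ℕ → List ℕ → Set
as ⊴ bs = ∀ {us} → Cover as us → ∃[ us′ ] Cover bs us′ × map kind us ↭ map kind us′

≼⇒⊴ : ∀ {a as b bs} → signs (a ∷ as) ≼ signs (b ∷ bs) → a ∷ as ⊴ b ∷ bs
≼⇒⊴ a≼b (some S) = let us′ , S′ , p = a≼b S in us′ , some S′ , p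

⊴-trans : ∀ {as bs cs} → as ⊴ bs → bs ⊴ cs → as ⊴ cs
⊴-trans a⊴b b⊴c C = let _ , C′ , p = a⊴b C
                        us , C″ , q = b⊴c C′ in us , C″ , ↭-trans p q

-- Cutting `as` into its blocks forces a segmentation of `bs` into equally many pure segments, and
-- `greedy` compares these with the parts of `bs`.
blocks-↭ : ∀ {as bs} → All NonZero as → All NonZero bs → as ⊴ bs →
           length bs ≤ length as × (length bs ≡ length as → as ↭ bs)
blocks-↭ {as} {bs} nza nzb a⊴b
  with us , C , p ← a⊴b (subst₂ Cover (List.++-identityʳ as) (List.++-identityʳ _) (cover-blocks as none)) =
  let p′ : map kind us ↭ map pure as
      p′ = ↭-trans (↭-sym p) (↭-reflexive (kinds-blocks nza))
      len : length us ≡ length as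
      len = ≡.trans (sym (List.length-map kind us)) (≡.trans (↭-length p′) (List.length-map pure as))
      le , eq = greedy {Q = λ _ → ⊤} _ {rest = []} {cs = []} (λ _ → nothing-left)
                 bs us nzb (All.universal _ _) (all-pure p′)
                 (subst₂ Cover (sym (List.++-identityʳ _)) (sym (List.++-identityʳ us)) C)
  in subst (length bs ≤_) len le
   , λ e → pure-injective (↭-trans (↭-sym p′) (↭-reflexive (eq (≡.trans e (sym len)))))
  where
  nothing-left : ∀ {b bs} → ¬ Cover (b ∷ bs) []
  nothing-left (some ())

parts-↭ : ∀ {as bs} → All NonZero as → All NonZero bs → as ⊴ bs → bs ⊴ as → as ↭ bs
parts-↭ nza nzb a⊴b b⊴a = let le , eq = blocks-↭ nza nzb a⊴b in
  eq (ℕ.≤-antisym le (proj₁ (blocks-↭ nzb nza b⊴a)))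

-- Reversal

signs-∷ʳ : ∀ a as c → pathSigns a (as ∷ʳ c) ≡ pathSigns a as ++ neg ∷ block c
signs-∷ʳ a []       c = refl
signs-∷ʳ a (b ∷ as) c = ≡.trans (cong (λ s → block a ++ neg ∷ s) (signs-∷ʳ b as c))
                                (sym (List.++-assoc (block a) (neg ∷ pathSigns b as) (neg ∷ block c)))

signs-++ : ∀ as b → .{{NonZero (length as)}} → signs (as ∷ʳ b) ≡ signs as ++ neg ∷ block b
signs-++ (a ∷ as) b = signs-∷ʳ a as b

reverse-replicate : ∀ n (x : A) → reverse (replicate n x) ≡ replicate n x
reverse-replicate zero    x = refl
reverse-replicate (suc n) x =
  ≡.trans (List.unfold-reverse x (replicate n x)) (≡.trans (cong (_∷ʳ x) (reverse-replicate n x)) (replicate-∷ʳ n))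
  where
  replicate-∷ʳ : ∀ n → replicate n x ∷ʳ x ≡ replicate (suc n) x
  replicate-∷ʳ zero    = refl
  replicate-∷ʳ (suc n) = cong (x ∷_) (replicate-∷ʳ n)

reverse-block : ∀ a → reverse (block a) ≡ block a
reverse-block a = reverse-replicate (pred a) pos

signs-reverse : ∀ as → signs (reverse as) ≡ reverse (signs as)
signs-reverse []           = refl
signs-reverse (a ∷ [])     = sym (reverse-block a)
signs-reverse (a ∷ b ∷ as) = begin
  signs (reverse (a ∷ b ∷ as))                      ≡⟨ cong signs (List.unfold-reverse a (b ∷ as)) ⟩
  signs (reverse (b ∷ as) ∷ʳ a)                     ≡⟨ signs-++ (reverse (b ∷ as)) a {{subst NonZero (sym (List.length-reverse (b ∷ as))) _}} ⟩
  signs (reverse (b ∷ as)) ++ neg ∷ block a         ≡⟨ cong₂ (λ s t → s ++ neg ∷ t) (signs-reverse (b ∷ as)) (sym (reverse-block a)) ⟩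
  reverse (signs (b ∷ as)) ++ neg ∷ reverse (block a) ≡⟨ List.++-assoc (reverse (signs (b ∷ as))) [ neg ] (reverse (block a)) ⟨
  (reverse (signs (b ∷ as)) ∷ʳ neg) ++ reverse (block a) ≡⟨ cong (_++ reverse (block a)) (List.unfold-reverse neg (signs (b ∷ as))) ⟨
  reverse (neg ∷ signs (b ∷ as)) ++ reverse (block a) ≡⟨ List.reverse-++ (block a) (neg ∷ signs (b ∷ as)) ⟨
  reverse (signs (a ∷ b ∷ as))                      ∎
  where open ≡-Reasoning

cover-reverse : ∀ bs → Cover bs us → Cover (reverse bs) (reverseSegs us)
cover-reverse []       none = none
cover-reverse (b ∷ bs) (some {us = us} S) = cover (reverse (b ∷ bs)) (List.length-reverse (b ∷ bs))
  (subst (λ s → Segs s (reverseSegs us)) (sym (signs-reverse (b ∷ bs))) (segs-reverse S))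
  where
  cover : ∀ {n us} cs → length cs ≡ suc n → Segs (signs cs) us → Cover cs us
  cover (c ∷ cs) _ S = some S

⊴-reverse : ∀ as → as ⊴ reverse as
⊴-reverse as {us} C = reverseSegs us , cover-reverse as C , ↭-sym (kinds-reverse us)

-- Compositions of length at most four

whole : ∀ {a as b bs} → a ∷ as ⊴ b ∷ bs → kind (pathSigns a as) ≡ kind (pathSigns b bs)
whole {a} {as} {b} {bs} a⊴b with a⊴b (some (segs-whole (pathSigns a as)))
... | us , some S , p with us | ↭-singleton-inv (↭-sym p)
...   | v ∷ [] | e = ≡.trans (sym (List.∷-injectiveˡ e)) (cong kind (segs-whole⁻ S))

EqualOrReverse : List ℕ → List ℕ → Set
EqualOrReverse as bs = as ≡ bs ⊎ as ≡ reverse bs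

ty-block : ∀ a → .{{NonZero a}} → ty (block a) ≡ pure a
ty-block (suc a) = ty-run a

-- The effect of prepending a block of `a` vertices and a negative edge: the block belongs to the
-- class opposite to the first vertex of the rest.
swapAdd : ℕ → Type → Type
swapAdd a (x , y) = a + y , x

ty-pathSigns : ∀ a b bs → .{{NonZero a}} → ty (pathSigns a (b ∷ bs)) ≡ swapAdd a (ty (pathSigns b bs))
ty-pathSigns (suc a) b bs = go a
  where
  go : ∀ a → ty (run a ++ neg ∷ pathSigns b bs) ≡ swapAdd (suc a) (ty (pathSigns b bs))
  go zero    = refl
  go (suc a) = cong (bump pos) (go a)

norm-injective : ∀ a b c d → norm (a , b) ≡ norm (c , d) → (a ≡ c × b ≡ d) ⊎ (a ≡ d × b ≡ c)
norm-injective a b c d e with norm-cases a b | norm-cases c d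
... | inj₁ p | inj₁ q = inj₁ (,-injective (≡.trans (sym p) (≡.trans e q)))
... | inj₁ p | inj₂ q = inj₂ (,-injective (≡.trans (sym p) (≡.trans e q)))
... | inj₂ p | inj₁ q = inj₂ (Product.swap (,-injective (≡.trans (sym p) (≡.trans e q))))
... | inj₂ p | inj₂ q = inj₁ (Product.swap (,-injective (≡.trans (sym p) (≡.trans e q))))

pair-↭ : {a b c d : A} → a ∷ b ∷ [] ↭ c ∷ d ∷ [] → (a ≡ c × b ≡ d) ⊎ (a ≡ d × b ≡ c)
pair-↭ p with ∈-resp-↭ p (here refl)
... | here refl         = inj₁ (refl , sym (List.∷-injectiveˡ (↭-singleton-inv (↭-sym (drop-∷ p)))))
... | there (here refl) = inj₂ (refl , sym (List.∷-injectiveˡ (↭-singleton-inv (↭-sym (drop-mid [] [ _ ] p)))))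

total₃ : ∀ a b c → .{{NonZero a}} → .{{NonZero b}} → .{{NonZero c}} →
         kind (pathSigns a (b ∷ c ∷ [])) ≡ norm (a + c , b)
total₃ a b c = cong norm (begin
  ty (pathSigns a (b ∷ c ∷ []))  ≡⟨ ty-pathSigns a b (c ∷ []) ⟩
  swapAdd a (ty (pathSigns b (c ∷ []))) ≡⟨ cong (swapAdd a) (ty-pathSigns b c []) ⟩
  swapAdd a (swapAdd b (ty (block c)))  ≡⟨ cong (swapAdd a ∘ swapAdd b) (ty-block c) ⟩
  (a + c , b + 0)                       ≡⟨ cong (a + c ,_) (ℕ.+-identityʳ b) ⟩
  (a + c , b)                           ∎)
  where open ≡-Reasoning

total₄ : ∀ a b c d → .{{NonZero a}} → .{{NonZero b}} → .{{NonZero c}} → .{{NonZero d}} →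
         kind (pathSigns a (b ∷ c ∷ d ∷ [])) ≡ norm (a + c , b + d)
total₄ a b c d = cong norm (begin
  ty (pathSigns a (b ∷ c ∷ d ∷ []))                 ≡⟨ ty-pathSigns a b (c ∷ d ∷ []) ⟩
  swapAdd a (ty (pathSigns b (c ∷ d ∷ [])))         ≡⟨ cong (swapAdd a) (ty-pathSigns b c (d ∷ [])) ⟩
  swapAdd a (swapAdd b (ty (pathSigns c (d ∷ []))))  ≡⟨ cong (swapAdd a ∘ swapAdd b) (ty-pathSigns c d []) ⟩
  swapAdd a (swapAdd b (swapAdd c (ty (block d))))   ≡⟨ cong (swapAdd a ∘ swapAdd b ∘ swapAdd c) (ty-block d) ⟩
  (a + (c + 0) , b + d)                             ≡⟨ cong (λ x → a + x , b + d) (ℕ.+-identityʳ c) ⟩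
  (a + c , b + d)                                   ∎)
  where open ≡-Reasoning

-- Equal middle parts leave only the ends to be exchanged. Otherwise the totals give b′ = a + c,
-- which exceeds both `a` and `c`; being one of the three parts, b′ is then `b` after all.
equal-or-reverse₃ : ∀ a b c a′ b′ c′ → .{{NonZero a}} → .{{NonZero b}} → .{{NonZero c}} →
  .{{NonZero a′}} → .{{NonZero b′}} → .{{NonZero c′}} →
  a ∷ b ∷ c ∷ [] ⊴ a′ ∷ b′ ∷ c′ ∷ [] →
  a ∷ b ∷ c ∷ [] ↭ a′ ∷ b′ ∷ c′ ∷ [] →
  EqualOrReverse (a ∷ b ∷ c ∷ []) (a′ ∷ b′ ∷ c′ ∷ [])
equal-or-reverse₃ a b c a′ b′ c′ a⊴ p = [ same-middle ∘ proj₂ , same-middle ∘ other ]′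
  (norm-injective (a + c) b (a′ + c′) b′
    (≡.trans (sym (total₃ a b c)) (≡.trans (whole a⊴) (total₃ a′ b′ c′))))
  where
  same-middle : b ≡ b′ → _
  same-middle refl = Sum.map (λ { (refl , refl) → refl }) (λ { (refl , refl) → refl })
    (pair-↭ (drop-mid [ a ] [ a′ ] p))
  m≢m+n : ∀ m n → .{{NonZero n}} → m ≢ m + n
  m≢m+n m n e = ℕ.<⇒≢ (ℕ.m<m+n m (>-nonZero⁻¹ n)) e
  other : a + c ≡ b′ × b ≡ a′ + c′ → b ≡ b′
  other (e , _) with ∈-resp-↭ (↭-sym p) (there (here refl))
  ... | here b′≡a                 = contradiction (sym (≡.trans e b′≡a)) (m≢m+n a c)
  ... | there (here b′≡b)         = sym b′≡b
  ... | there (there (here b′≡c)) = contradiction (≡.trans (sym b′≡c) (≡.trans (sym e) (ℕ.+-comm a c))) (m≢m+n c a)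

-- The first part has `b` inner edges, all positive, and a segment this short does not leave it.
run-short : ∀ {b bs} → Segs (pathSigns (suc b) bs) (u ∷ us) → length u ≤ b → u ≡ run (length u)
run-short {u = []} S _ = refl
run-short {u = σ ∷ u} {b = suc b} {bs} S (s≤s u≤b) with pathSigns (suc (suc b)) bs | pathSigns-suc b bs
run-short {u = σ ∷ u} {b = suc b} {bs} (join S) (s≤s u≤b) | _ | refl = cong (pos ∷_) (run-short {bs = bs} S u≤b)

size : ∀ u → proj₁ (kind u) + proj₂ (kind u) ≡ suc (length u)
size u = ≡.trans (norm-size (ty u)) (ty-size u)
  where
  norm-size : ∀ t → proj₁ (norm t) + proj₂ (norm t) ≡ proj₁ t + proj₂ t
  norm-size (a , b) with norm-cases a b
  ... | inj₁ e = cong (λ t → proj₁ t + proj₂ t) e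
  ... | inj₂ e = ≡.trans (cong (λ t → proj₁ t + proj₂ t) e) (ℕ.+-comm b a)
  ty-size : ∀ u → proj₁ (ty u) + proj₂ (ty u) ≡ suc (length u)
  ty-size []        = refl
  ty-size (pos ∷ u) = cong suc (ty-size u)
  ty-size (neg ∷ u) = cong suc (≡.trans (ℕ.+-comm (proj₂ (ty u)) _) (ty-size u))

two-segments : ∀ {k l} → k ∷ l ∷ [] ↭ map kind us → ∃[ v ] ∃[ w ] us ≡ v ∷ w ∷ [] × k ∷ l ∷ [] ↭ kind v ∷ kind w ∷ []
two-segments {us = []}              p = contradiction (↭-length p) λ ()
two-segments {us = _ ∷ []}          p = contradiction (↭-length p) λ ()
two-segments {us = v ∷ w ∷ []}      p = v , w , refl , p
two-segments {us = _ ∷ _ ∷ _ ∷ _}   p = contradiction (↭-length p) λ ()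

pure-first : ∀ {b bs k} → .{{NonZero b}} → Cover (b ∷ bs) (u ∷ us) → kind u ≡ pure k → k ≤ b
pure-first C e with pure-step C (cong proj₂ e)
... | n , kn , rest = ℕ.≤-trans (ℕ.≤-reflexive (≡.trans (sym (cong proj₁ e)) (cong proj₁ kn)))
  ([ ℕ.≤-reflexive ∘ proj₁ , (λ (r , e , _) → subst (suc n ≤_) (sym e) (ℕ.m≤m+n (suc n) (suc r))) ]′ rest)

-- Cut off the first part. In a matching segmentation into two segments, the pure segment of size
-- `a` comes first or last, so it fits into an end part.
first≤ends : ∀ a b c d a′ b′ c′ d′ → .{{NonZero a}} → .{{NonZero a′}} → .{{NonZero d′}} →
  a ∷ b ∷ c ∷ d ∷ [] ⊴ a′ ∷ b′ ∷ c′ ∷ d′ ∷ [] → a ≤ a′ ⊔ d′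
first≤ends a b c d a′ b′ c′ d′ a⊴
  with us , C , p ← a⊴ (cover-block {b = a} (some (segs-whole (pathSigns b (c ∷ d ∷ [])))))
  with v , w , refl , q ← two-segments p
  with ∈-resp-↭ q (here refl)
... | here e         = ℕ.≤-trans (pure-first C (≡.trans (sym e) (kind-block a))) (ℕ.m≤m⊔n a′ d′)
... | there (here e) = ℕ.≤-trans
  (pure-first (cover-reverse (a′ ∷ b′ ∷ c′ ∷ d′ ∷ []) C) (≡.trans (kind-reverse w) (≡.trans (sym e) (kind-block a))))
  (ℕ.m≤n⊔m a′ d′)

-- The first segment takes one vertex of the second part. If that vertex is the whole part, the cut
-- edge is the negative edge before `c`, and the edge between `c` and `d` still makes the other
-- segment mixed.
mixed-cut : ∀ a b c d → .{{NonZero b}} →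
            ∃[ t ] neg ∈ t × Segs (pathSigns a (b ∷ c ∷ d ∷ [])) ((block a ∷ʳ neg) ∷ t ∷ [])
mixed-cut a (suc zero) c d = pathSigns c (d ∷ []) , ∈-++⁺ʳ (block c) (here refl) ,
  subst (λ s → Segs s (_ ∷ _ ∷ [])) (List.++-assoc (block a) [ neg ] _) (segs-++ (block a ∷ʳ neg) (segs-whole _))
mixed-cut a (suc (suc b)) c d = pathSigns (suc b) (c ∷ d ∷ []) , ∈-++⁺ʳ (run b) (here refl) ,
  subst (λ s → Segs s (_ ∷ _ ∷ [])) (List.++-assoc (block a) [ neg ] _) (segs-++ (block a ∷ʳ neg) (segs-whole _))

-- The first part and one more vertex form a mixed segment, but if both ends of
-- the second composition were longer, a segment of that size there would be pure.
ends≤first : ∀ a b c d a′ b′ c′ d′ → .{{NonZero a}} → .{{NonZero b}} → .{{NonZero a′}} → .{{NonZero d′}} →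
  a ∷ b ∷ c ∷ d ∷ [] ⊴ a′ ∷ b′ ∷ c′ ∷ d′ ∷ [] → a′ ⊓ d′ ≤ a
ends≤first (suc a) b c d (suc a′) b′ c′ (suc d′) a⊴ with suc a′ ⊓ suc d′ ℕ.≤? suc a
... | yes le = le
... | no ≰a
  with t , neg∈t , S ← mixed-cut (suc a) b c d
  with us , C , p ← a⊴ (some S)
  with v , w , refl , q ← two-segments p
  = contradiction (∈-resp-↭ q (here refl)) absurd
  where
  a<a′ : suc a ≤ a′
  a<a′ = s≤s⁻¹ (ℕ.≤-trans (ℕ.≰⇒> ≰a) (ℕ.m⊓n≤m (suc a′) (suc d′)))
  a<d′ : suc a ≤ d′
  a<d′ = s≤s⁻¹ (ℕ.≤-trans (ℕ.≰⇒> ≰a) (ℕ.m⊓n≤n (suc a′) (suc d′)))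
  mixed : ∀ {x} → x ∈ kind v ∷ kind w ∷ [] → proj₂ x ≢ 0
  mixed x∈ with ∈-resp-↭ (↭-sym q) x∈
  ... | here refl         = neg⇒mixed (∈-++⁺ʳ (run a) (here refl))
  ... | there (here refl) = neg⇒mixed neg∈t
  size-x : ∀ y → kind (run a ∷ʳ neg) ≡ kind y → length y ≡ suc a
  size-x y e = ℕ.suc-injective (begin
    suc (length y)                 ≡⟨ size y ⟨
    proj₁ (kind y) + proj₂ (kind y) ≡⟨ cong (λ k → proj₁ k + proj₂ k) e ⟨
    _                              ≡⟨ size (run a ∷ʳ neg) ⟩
    suc (length (run a ∷ʳ neg))    ≡⟨ cong suc (List.length-++ (run a)) ⟩
    suc (length (run a) + 1)       ≡⟨ cong suc (ℕ.+-comm (length (run a)) 1) ⟩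
    suc (suc (length (run a)))     ≡⟨ cong (suc ∘ suc) (List.length-replicate a) ⟩
    suc (suc a)                    ∎)
    where open ≡-Reasoning
  run-pure : ∀ y → y ≡ run (length y) → Pure y
  run-pure y e = ≡.trans (cong (proj₂ ∘ kind) e) (cong proj₂ (kind-run (length y)))
  absurd : ¬ (kind (run a ∷ʳ neg) ∈ kind v ∷ kind w ∷ [])
  absurd (here e) = mixed (here refl)
    (run-pure v (run-short {bs = b′ ∷ c′ ∷ suc d′ ∷ []} (cover⁻ C) (ℕ.≤-trans (ℕ.≤-reflexive (size-x v e)) a<a′)))
  -- If the segment of this size comes last, reversal moves it to the front, where it fits into the
  -- other end part.
  absurd (there (here e)) = mixed (there (here refl)) (≡.trans (sym (cong proj₂ (kind-reverse w)))
    (run-pure (reverse w) (run-short {bs = c′ ∷ b′ ∷ suc a′ ∷ []} (cover⁻ (cover-reverse (suc a′ ∷ b′ ∷ c′ ∷ suc d′ ∷ []) C))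
      (ℕ.≤-trans (ℕ.≤-reflexive (≡.trans (List.length-reverse w) (size-x w e))) a<d′))))

-- `first≤ends` and its reversed forms identify the maximum of the two ends, `ends≤first` and its
-- reversed forms the minimum.
same-ends : ∀ a b c d a′ b′ c′ d′ → .{{NonZero a}} → .{{NonZero b}} → .{{NonZero c}} → .{{NonZero d}} →
  .{{NonZero a′}} → .{{NonZero b′}} → .{{NonZero c′}} → .{{NonZero d′}} →
  a ∷ b ∷ c ∷ d ∷ [] ⊴ a′ ∷ b′ ∷ c′ ∷ d′ ∷ [] →
  a′ ∷ b′ ∷ c′ ∷ d′ ∷ [] ⊴ a ∷ b ∷ c ∷ d ∷ [] →
  (a ≡ a′ × d ≡ d′) ⊎ (a ≡ d′ × d ≡ a′)
same-ends a b c d a′ b′ c′ d′ a⊴ ⊴a = norm-injective a d a′ d′ (cong₂ _,_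
  (ℕ.≤-antisym (ℕ.⊔-lub (first≤ends a b c d a′ b′ c′ d′ a⊴) (first≤ends d c b a a′ b′ c′ d′ r⊴))
               (ℕ.⊔-lub (first≤ends a′ b′ c′ d′ a b c d ⊴a) (first≤ends d′ c′ b′ a′ a b c d ⊴r)))
  (ℕ.≤-antisym (ℕ.⊓-glb (ends≤first a′ b′ c′ d′ a b c d ⊴a) (ends≤first d′ c′ b′ a′ a b c d ⊴r))
               (ℕ.⊓-glb (ends≤first a b c d a′ b′ c′ d′ a⊴) (ends≤first d c b a a′ b′ c′ d′ r⊴))))
  where
  r⊴ : d ∷ c ∷ b ∷ a ∷ [] ⊴ a′ ∷ b′ ∷ c′ ∷ d′ ∷ []
  r⊴ = ⊴-trans (⊴-reverse (d ∷ c ∷ b ∷ a ∷ [])) a⊴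
  ⊴r : d′ ∷ c′ ∷ b′ ∷ a′ ∷ [] ⊴ a ∷ b ∷ c ∷ d ∷ []
  ⊴r = ⊴-trans (⊴-reverse (d′ ∷ c′ ∷ b′ ∷ a′ ∷ [])) ⊴a

-- If the inner parts are exchanged, the totals give either b = c, so that the lists coincide, or a
-- = d, so that the exchange is a reversal.
fixed-ends : ∀ a b c d b′ c′ → .{{NonZero a}} → .{{NonZero b}} → .{{NonZero c}} → .{{NonZero d}} →
  .{{NonZero b′}} → .{{NonZero c′}} →
  a ∷ b ∷ c ∷ d ∷ [] ⊴ a ∷ b′ ∷ c′ ∷ d ∷ [] →
  a ∷ b ∷ c ∷ d ∷ [] ↭ a ∷ b′ ∷ c′ ∷ d ∷ [] →
  EqualOrReverse (a ∷ b ∷ c ∷ d ∷ []) (a ∷ b′ ∷ c′ ∷ d ∷ [])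
fixed-ends a b c d b′ c′ a⊴ p with pair-↭ (++-cancelʳ-↭ {xs = b ∷ c ∷ []} {b′ ∷ c′ ∷ []} {[ d ]} ↭-refl (drop-∷ p))
... | inj₁ (refl , refl) = inj₁ refl
... | inj₂ (refl , refl)
  with norm-injective (a + c) (b + d) (a + b) (c + d)
         (≡.trans (sym (total₄ a b c d)) (≡.trans (whole a⊴) (total₄ a c b d)))
...   | inj₁ (e , _) with refl ← ℕ.+-cancelˡ-≡ a c b e = inj₁ refl
...   | inj₂ (e , _) with refl ← ℕ.+-cancelʳ-≡ c a d (≡.trans e (ℕ.+-comm c d)) = inj₂ refl

equal-or-reverse₄ : ∀ a b c d a′ b′ c′ d′ → .{{NonZero a}} → .{{NonZero b}} → .{{NonZero c}} → .{{NonZero d}} →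
  .{{NonZero a′}} → .{{NonZero b′}} → .{{NonZero c′}} → .{{NonZero d′}} →
  a ∷ b ∷ c ∷ d ∷ [] ⊴ a′ ∷ b′ ∷ c′ ∷ d′ ∷ [] →
  a′ ∷ b′ ∷ c′ ∷ d′ ∷ [] ⊴ a ∷ b ∷ c ∷ d ∷ [] →
  a ∷ b ∷ c ∷ d ∷ [] ↭ a′ ∷ b′ ∷ c′ ∷ d′ ∷ [] →
  EqualOrReverse (a ∷ b ∷ c ∷ d ∷ []) (a′ ∷ b′ ∷ c′ ∷ d′ ∷ [])
equal-or-reverse₄ a b c d a′ b′ c′ d′ a⊴ ⊴a p with same-ends a b c d a′ b′ c′ d′ a⊴ ⊴a
... | inj₁ (refl , refl) = fixed-ends a b c d b′ c′ a⊴ p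
... | inj₂ (refl , refl) = Sum.swap (fixed-ends a b c d c′ b′
        (⊴-trans a⊴ (⊴-reverse (a′ ∷ b′ ∷ c′ ∷ d′ ∷ [])))
        (↭-trans p (↭-sym (↭-reverse (a′ ∷ b′ ∷ c′ ∷ d′ ∷ [])))))

equal-or-reverse≤4 : ∀ {a as b bs} → All NonZero (a ∷ as) → All NonZero (b ∷ bs) →
  a ∷ as ⊴ b ∷ bs → b ∷ bs ⊴ a ∷ as → length (a ∷ as) ≤ 4 →
  EqualOrReverse (a ∷ as) (b ∷ bs)
equal-or-reverse≤4 {a} {as} {b} {bs} nza nzb a⊴b b⊴a ≤4 =
  go as bs nza nzb a⊴b b⊴a (parts-↭ nza nzb a⊴b b⊴a) ≤4
  where
  go : ∀ as bs → All NonZero (a ∷ as) → All NonZero (b ∷ bs) →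
       a ∷ as ⊴ b ∷ bs → b ∷ bs ⊴ a ∷ as → a ∷ as ↭ b ∷ bs → length (a ∷ as) ≤ 4 →
       EqualOrReverse (a ∷ as) (b ∷ bs)
  go [] bs _ _ _ _ p _ = inj₁ (sym (↭-singleton-inv (↭-sym p)))
  go (a₂ ∷ []) (b₂ ∷ []) _ _ _ _ p _ =
    Sum.map (λ { (refl , refl) → refl }) (λ { (refl , refl) → refl }) (pair-↭ p)
  go (a₂ ∷ a₃ ∷ []) (b₂ ∷ b₃ ∷ []) (n₁ ∷ n₂ ∷ n₃ ∷ []) (m₁ ∷ m₂ ∷ m₃ ∷ []) a⊴b b⊴a p _ =
    equal-or-reverse₃ a a₂ a₃ b b₂ b₃ {{n₁}} {{n₂}} {{n₃}} {{m₁}} {{m₂}} {{m₃}} a⊴b p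
  go (a₂ ∷ a₃ ∷ a₄ ∷ []) (b₂ ∷ b₃ ∷ b₄ ∷ []) (n₁ ∷ n₂ ∷ n₃ ∷ n₄ ∷ []) (m₁ ∷ m₂ ∷ m₃ ∷ m₄ ∷ []) a⊴b b⊴a p _ =
    equal-or-reverse₄ a a₂ a₃ a₄ b b₂ b₃ b₄ {{n₁}} {{n₂}} {{n₃}} {{n₄}} {{m₁}} {{m₂}} {{m₃}} {{m₄}} a⊴b b⊴a p
  go (_ ∷ []) []                _ _ _ _ p _ = contradiction (↭-length p) λ ()
  go (_ ∷ []) (_ ∷ _ ∷ _)       _ _ _ _ p _ = contradiction (↭-length p) λ ()
  go (_ ∷ _ ∷ []) []            _ _ _ _ p _ = contradiction (↭-length p) λ ()
  go (_ ∷ _ ∷ []) (_ ∷ [])      _ _ _ _ p _ = contradiction (↭-length p) λ ()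
  go (_ ∷ _ ∷ []) (_ ∷ _ ∷ _ ∷ _) _ _ _ _ p _ = contradiction (↭-length p) λ ()
  go (_ ∷ _ ∷ _ ∷ []) []        _ _ _ _ p _ = contradiction (↭-length p) λ ()
  go (_ ∷ _ ∷ _ ∷ []) (_ ∷ [])  _ _ _ _ p _ = contradiction (↭-length p) λ ()
  go (_ ∷ _ ∷ _ ∷ []) (_ ∷ _ ∷ []) _ _ _ _ p _ = contradiction (↭-length p) λ ()
  go (_ ∷ _ ∷ _ ∷ []) (_ ∷ _ ∷ _ ∷ _ ∷ _) _ _ _ _ p _ = contradiction (↭-length p) λ ()
  go (_ ∷ _ ∷ _ ∷ _ ∷ _) _      _ _ _ _ _ (s≤s (s≤s (s≤s (s≤s ()))))

-- Unimodal compositions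

-- Both slopes are listed from the outside inwards, so reversal just exchanges them; `m` counts the
-- copies of `t` beyond the first.
mountain : List ℕ → ℕ → ℕ → List ℕ → List ℕ
mountain as m t bs = as ++ t ∷ replicate m t ++ reverse bs

mountain-reverse : ∀ as m t bs → reverse (mountain as m t bs) ≡ mountain bs m t as
mountain-reverse as m t bs = begin
  reverse (as ++ replicate (suc m) t ++ reverse bs)
    ≡⟨ List.reverse-++ as _ ⟩
  reverse (replicate (suc m) t ++ reverse bs) ++ reverse as
    ≡⟨ cong (_++ reverse as) (List.reverse-++ (replicate (suc m) t) (reverse bs)) ⟩
  (reverse (reverse bs) ++ reverse (replicate (suc m) t)) ++ reverse as
    ≡⟨ cong₂ (λ xs ys → (xs ++ ys) ++ reverse as) (List.reverse-involutive bs) (reverse-replicate (suc m) t) ⟩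
  (bs ++ replicate (suc m) t) ++ reverse as
    ≡⟨ List.++-assoc bs _ _ ⟩
  mountain bs m t as ∎
  where open ≡-Reasoning

reverseSegs-++ : ∀ pre v post → reverseSegs (pre ++ v ∷ post) ≡ reverseSegs post ++ reverse v ∷ reverseSegs pre
reverseSegs-++ pre v post = begin
  reverse (map reverse (pre ++ v ∷ post))
    ≡⟨ cong reverse (List.map-++ reverse pre (v ∷ post)) ⟩
  reverse (map reverse pre ++ reverse v ∷ map reverse post)
    ≡⟨ List.reverse-++ (map reverse pre) _ ⟩
  reverse (reverse v ∷ map reverse post) ++ reverseSegs pre
    ≡⟨ cong (_++ reverseSegs pre) (List.unfold-reverse (reverse v) (map reverse post)) ⟩
  (reverseSegs post ∷ʳ reverse v) ++ reverseSegs pre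
    ≡⟨ List.++-assoc (reverseSegs post) _ _ ⟩
  reverseSegs post ++ reverse v ∷ reverseSegs pre ∎
  where open ≡-Reasoning

-- A pure segment of size t does not fit into a part below t, so the segments before
-- it have to use up the whole slope.
climb-left : ∀ {as t as′ cs v} pre post → All NonZero as′ → All (_< t) as′ →
  Cover (as′ ++ cs) (pre ++ v ∷ post) → map kind (pre ++ post) ↭ map pure (as ∷ʳ t) →
  pure t ∈ map kind pre → length as′ ≤ length as × (length as′ ≡ length as → as′ ↭ as)
climb-left {as} {t} {as′} {cs} {v} pre post nz <t C p t∈
  with w , w∈ , e ← ∈-map⁻ kind t∈
  with vs , ws , refl ← ∈-∃++ w∈ =
  ℕ.≤-trans le vs≤as , λ as′≡as → pure-injective (begin
    map pure as′                        ≡⟨ eq (ℕ.≤-antisym le (ℕ.≤-trans vs≤as (ℕ.≤-reflexive (sym as′≡as)))) ⟨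
    map kind vs                         ≡⟨ cong (map kind) (List.++-identityʳ vs) ⟨
    map kind (vs ++ [])                 ≡⟨ cong (λ z → map kind (vs ++ z)) (rest-empty (ℕ.≤-trans (ℕ.≤-reflexive (sym as′≡as)) le)) ⟨
    map kind (vs ++ ws ++ post)         ↭⟨ q ⟩
    map pure as                         ∎)
  where
  open PermutationReasoning
  q : map kind (vs ++ ws ++ post) ↭ map pure as
  q = drop-∷ {x = pure t} (begin
    pure t ∷ map kind (vs ++ ws ++ post)  ≡⟨ cong (_∷ map kind (vs ++ ws ++ post)) e ⟩
    map kind (w ∷ vs ++ ws ++ post)       ↭⟨ ↭.map⁺ kind (shift w vs (ws ++ post)) ⟨
    map kind (vs ++ w ∷ ws ++ post)       ≡⟨ cong (map kind) (List.++-assoc vs (w ∷ ws) post) ⟨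
    map kind ((vs ++ w ∷ ws) ++ post)     ↭⟨ p ⟩
    map pure (as ∷ʳ t)                    ↭⟨ ↭.map⁺ pure (↭.∷↭∷ʳ t as) ⟨
    map pure (t ∷ as)                     ∎)
  lengths : length vs + length (ws ++ post) ≡ length as
  lengths = ≡.trans (sym (List.length-++ vs)) (≡.trans (sym (List.length-map kind (vs ++ ws ++ post)))
    (≡.trans (↭-length q) (List.length-map pure as)))
  vs≤as : length vs ≤ length as
  vs≤as = subst (length vs ≤_) lengths (ℕ.m≤m+n (length vs) _)
  -- If the segments before `w` are as numerous as `as`, they account for all pure segments other
  -- than `w`.
  rest-empty : length as ≤ length vs → ws ++ post ≡ []
  rest-empty as≤vs = length≡0 (ws ++ post) (ℕ.n≤0⇒n≡0 (ℕ.+-cancelˡ-≤ (length vs) _ 0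
    (ℕ.≤-trans (ℕ.≤-reflexive lengths) (ℕ.≤-trans as≤vs (ℕ.m≤m+n _ 0)))))
    where
    length≡0 : (xs : List (List Sign)) → length xs ≡ 0 → xs ≡ []
    length≡0 [] _ = refl
  -- `w` plays the role of the stopping segment in `greedy`: it has size `t` and cannot start in
  -- what is left of a slope.
  too-long : ∀ {b bs} → .{{NonZero b}} → b < t → ¬ Cover (b ∷ bs ++ cs) (w ∷ ws ++ v ∷ post)
  too-long b<t C′ = ℕ.<⇒≱ b<t (pure-first C′ (sym e))
  bound = greedy {Q = _< t} ℕ.≤-<-trans {cs = cs} too-long as′ vs nz <t
    (All.++⁻ˡ vs (All.++⁻ˡ (vs ++ w ∷ ws) (all-pure p)))
    (subst (Cover (as′ ++ cs)) (List.++-assoc vs (w ∷ ws) (v ∷ post)) C)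
  le = proj₁ bound
  eq = proj₂ bound

-- Let `v` be a segment matching the kind of the uncut rest. A pure segment of size `t` lies before
-- `v`, where `climb-left` applies, or after it, where `climb-left` applies to the reversed mountain
-- and the other slope.
climb : ∀ {as t r rs as′ m bs′} → All NonZero as → .{{NonZero t}} →
  All NonZero as′ → All (_< t) as′ → All NonZero bs′ → All (_< t) bs′ →
  as ++ t ∷ r ∷ rs ⊴ mountain as′ m t bs′ →
  (length as′ ≤ length as × (length as′ ≡ length as → as′ ↭ as)) ⊎
  (length bs′ ≤ length as × (length bs′ ≡ length as → bs′ ↭ as))
climb {as} {t} {r} {rs} {as′} {m} {bs′} nza nza′ as′<t nzb′ bs′<t a⊴
  with us , C , p ← a⊴ (cover-blocks as (cover-block {b = t} (some (segs-whole (pathSigns r rs)))))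
  with v , v∈ , k≡ ← ∈-map⁻ kind (∈-resp-↭ p (∈-map⁺ kind (∈-++⁺ʳ (map block as) (there (here refl)))))
  with pre , post , refl ← ∈-∃++ v∈ = [ left , right ]′ (∈-++⁻ (map kind pre)
    (subst (pure t ∈_) (List.map-++ kind pre post) (∈-resp-↭ (↭-sym q) (∈-map⁺ pure (∈-++⁺ʳ as (here refl))))))
  where
  open PermutationReasoning
  k = kind (pathSigns r rs)
  q : map kind (pre ++ post) ↭ map pure (as ∷ʳ t)
  q = drop-∷ (begin
    k ∷ map kind (pre ++ post)                ≡⟨ cong (_∷ map kind (pre ++ post)) k≡ ⟩
    map kind (v ∷ pre ++ post)                ↭⟨ ↭.map⁺ kind (shift v pre post) ⟨
    map kind (pre ++ v ∷ post)                ↭⟨ p ⟨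
    map kind (map block as ++ block t ∷ pathSigns r rs ∷ []) ≡⟨ List.map-++ kind (map block as) _ ⟩
    map kind (map block as) ++ kind (block t) ∷ k ∷ []       ≡⟨ cong₂ (λ xs x → xs ++ x ∷ k ∷ []) (kinds-blocks nza) (kind-block t) ⟩
    map pure as ++ pure t ∷ k ∷ []            ≡⟨ List.++-assoc (map pure as) [ pure t ] [ k ] ⟨
    (map pure as ∷ʳ pure t) ∷ʳ k              ↭⟨ ↭.∷↭∷ʳ k _ ⟨
    k ∷ (map pure as ∷ʳ pure t)               ≡⟨ cong (k ∷_) (List.map-++ pure as [ t ]) ⟨
    k ∷ map pure (as ∷ʳ t)                    ∎)
  left : pure t ∈ map kind pre → _
  left t∈ = inj₁ (climb-left pre post nza′ as′<t C q t∈)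
  right : pure t ∈ map kind post → _
  right t∈ = inj₂ (climb-left (reverseSegs post) (reverseSegs pre) nzb′ bs′<t
    (subst₂ Cover (mountain-reverse as′ m t bs′) (reverseSegs-++ pre v post) (cover-reverse _ C))
    (begin
      map kind (reverseSegs post ++ reverseSegs pre) ≡⟨ cong (map kind) (List.reverse-++ (map reverse pre) (map reverse post)) ⟨
      map kind (reverse (map reverse pre ++ map reverse post)) ≡⟨ cong (map kind ∘ reverse) (List.map-++ reverse pre post) ⟨
      map kind (reverseSegs (pre ++ post))           ↭⟨ kinds-reverse (pre ++ post) ⟩
      map kind (pre ++ post)                         ↭⟨ q ⟩
      map pure (as ∷ʳ t)                             ∎)
    (∈-resp-↭ (↭-sym (kinds-reverse post)) t∈))

-- The strict bound leaves all copies of the highest part to the plateau, which makes the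
-- decomposition of a mountain unique.
record Slope (t : ℕ) (as : List ℕ) : Set where
  constructor slope
  field
    ascending : AllPairs _≤_ as
    below     : All (_< t) as

record Ridge (cs : List ℕ) : Set where
  constructor ridge
  field
    {as}      : List ℕ
    {m}       : ℕ
    {t}       : ℕ
    {bs}      : List ℕ
    slopeˡ    : Slope t as
    slopeʳ    : Slope t bs
    shorterˡ  : length as ≤ length bs
    mountain≡ : mountain as m t bs ≡ cs

minimum : ∀ {x y xs} → All (x ≤_) xs → y ∈ x ∷ xs → x ≤ y
minimum x≤ (here refl) = ℕ.≤-refl
minimum x≤ (there y∈)  = All.lookup x≤ y∈

ascending-unique : ∀ {as bs} → AllPairs _≤_ as → AllPairs _≤_ bs → as ↭ bs → as ≡ bs
ascending-unique {[]}     {bs}     _ _ p = sym (↭.↭-empty-inv (↭-sym p))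
ascending-unique {a ∷ as} {[]}     _ _ p = contradiction (↭-length p) λ ()
ascending-unique {a ∷ as} {b ∷ bs} (a≤ ∷ ↗as) (b≤ ∷ ↗bs) p
  with refl ← ℕ.≤-antisym (minimum a≤ (∈-resp-↭ (↭-sym p) (here refl))) (minimum b≤ (∈-resp-↭ p (here refl)))
  = cong (a ∷_) (ascending-unique ↗as ↗bs (drop-∷ p))

∉-below : ∀ {t as} → All (_< t) as → ¬ t ∈ as
∉-below <t t∈ = ℕ.<-irrefl refl (All.lookup <t t∈)

replicate-cancel : ∀ m n {t : A} {xs ys} → ¬ t ∈ xs → ¬ t ∈ ys → replicate m t ++ xs ↭ replicate n t ++ ys →
                   m ≡ n × xs ↭ ys
replicate-cancel zero    zero    t∉xs t∉ys p = refl , p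
replicate-cancel zero    (suc n) t∉xs t∉ys p = contradiction (∈-resp-↭ (↭-sym p) (here refl)) t∉xs
replicate-cancel (suc m) zero    t∉xs t∉ys p = contradiction (∈-resp-↭ p (here refl)) t∉ys
replicate-cancel (suc m) (suc n) t∉xs t∉ys p = let m≡n , q = replicate-cancel m n t∉xs t∉ys (drop-∷ p) in
  cong suc m≡n , q

All-reverse : ∀ {P : A → Set} {xs} → All P xs → All P (reverse xs)
All-reverse {xs = xs} = ↭.All-resp-↭ (↭-sym (↭-reverse xs))

-- A slope is sorted, hence determined by its multiset. Cancelling the known slope and counting the
-- copies of `t` leaves the multiset of the other one.
mountain-determined : ∀ {as m t bs as′ m′ bs′} → Slope t as → Slope t bs → Slope t as′ → Slope t bs′ → as′ ↭ as →
  mountain as m t bs ↭ mountain as′ m′ t bs′ → mountain as m t bs ≡ mountain as′ m′ t bs′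
mountain-determined {as} {m} {t} {bs} {as′} {m′} {bs′} (slope ↗as <as) (slope ↗bs <bs) (slope ↗as′ _) (slope ↗bs′ <bs′) q p
  with refl ← ascending-unique ↗as′ ↗as q
  with m≡ , r ← replicate-cancel (suc m) (suc m′) (∉-below (All-reverse <bs)) (∉-below (All-reverse <bs′))
                  (++-cancelˡ-↭ as p)
  with refl ← ℕ.suc-injective m≡
  with refl ← ascending-unique ↗bs ↗bs′ (↭-trans (↭-sym (↭-reverse bs)) (↭-trans r (↭-reverse bs′)))
  = refl

mountain≤ : ∀ {as m t bs} → Slope t as → Slope t bs → All (_≤ t) (mountain as m t bs)
mountain≤ {m = m} (slope _ <as) (slope _ <bs) = All.++⁺ (All.map ℕ.<⇒≤ <as)
  (ℕ.≤-refl ∷ All.++⁺ (All.replicate⁺ m ℕ.≤-refl) (All-reverse (All.map ℕ.<⇒≤ <bs)))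

t∈mountain : ∀ as m t bs → t ∈ mountain as m t bs
t∈mountain as m t bs = ∈-++⁺ʳ as (here refl)

climb-ridge : ∀ {as m t bs as′ m′ bs′} → Slope t as′ → Slope t bs′ →
  All NonZero (mountain as m t bs) → All NonZero (mountain as′ m′ t bs′) →
  length as ≤ length bs → 1 < length (mountain as m t bs) → mountain as m t bs ⊴ mountain as′ m′ t bs′ →
  (length as′ ≤ length as × (length as′ ≡ length as → as′ ↭ as)) ⊎
  (length bs′ ≤ length as × (length bs′ ≡ length as → bs′ ↭ as))
climb-ridge {as} {m} {t} {bs} {as′} {m′} {bs′} (slope _ <as′) (slope _ <bs′) nz nz′ as≤bs 1< a⊴ = go (replicate m t ++ reverse bs) refl a⊴
  where
  nza = All.++⁻ˡ as nz
  nzt = All.head (All.++⁻ʳ as nz)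
  nza′ = All.++⁻ˡ as′ nz′
  nzb′ : All NonZero bs′
  nzb′ = ↭.All-resp-↭ (↭-reverse bs′) (All.++⁻ʳ (replicate m′ t) (All.tail (All.++⁻ʳ as′ nz′)))
  go : ∀ rs → replicate m t ++ reverse bs ≡ rs → as ++ t ∷ rs ⊴ mountain as′ m′ t bs′ → _
  go (r ∷ rs) _ a⊴ = climb {as = as} {m = m′} {bs′ = bs′} nza {{nzt}} nza′ <as′ nzb′ <bs′ a⊴
  -- Nothing after the first `t` means that `bs` is empty, hence also the shorter slope `as`,
  -- contrary to the length being above 1.
  go []       e _  = contradiction 1< (ℕ.≤⇒≯ (begin
    length (mountain as m t bs)                         ≡⟨ List.length-++ as ⟩
    length as + suc (length (replicate m t ++ reverse bs)) ≡⟨ cong (λ rs → length as + suc (length rs)) e ⟩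
    length as + 1                                       ≤⟨ ℕ.+-monoˡ-≤ 1 (ℕ.≤-trans as≤bs (ℕ.≤-reflexive bs≡0)) ⟩
    1                                                   ∎))
    where
    open ℕ.≤-Reasoning
    bs≡0 : length bs ≡ 0
    bs≡0 = ℕ.m+n≡0⇒n≡0 (length (replicate m t)) (≡.trans (cong (λ k → length (replicate m t) + k) (sym (List.length-reverse bs)))
      (≡.trans (sym (List.length-++ (replicate m t))) (cong length e)))

-- The peaks agree, being the maxima of the same multiset. Climbing in both directions shows that
-- the shorter slopes have equal lengths, so one slope of the second mountain is a permutation of
-- `as`; which one decides between equality and reversal.
ridge-equal-or-reverse : ∀ {as bs} → Ridge as → Ridge bs → All NonZero as → All NonZero bs →
                         as ⊴ bs → bs ⊴ as → 1 < length as → EqualOrReverse as bs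
ridge-equal-or-reverse
  (ridge {as} {m} {t} {bs} sa sb as≤bs refl) (ridge {as′} {m′} {t′} {bs′} sa′ sb′ as′≤bs′ refl) nz nz′ a⊴ ⊴a 1<
  with p ← parts-↭ nz nz′ a⊴ ⊴a
  with refl ← ℕ.≤-antisym
         (All.lookup (mountain≤ {m = m′} sa′ sb′) (∈-resp-↭ p (t∈mountain as m t bs)))
         (All.lookup (mountain≤ {m = m} sa sb) (∈-resp-↭ (↭-sym p) (t∈mountain as′ m′ t′ bs′)))
  = conclude (climb-ridge {m = m} {bs = bs} {m′ = m′} sa′ sb′ nz nz′ as≤bs 1< a⊴)
             (climb-ridge {m = m′} {bs = bs′} {m′ = m} sa sb nz′ nz as′≤bs′ (subst (1 <_) (↭-length p) 1<) ⊴a)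
  where
  conclude : _ → _ → EqualOrReverse (mountain as m t bs) (mountain as′ m′ t bs′)
  conclude f g = [ same , reversed ]′ f
    where
    as′≡as : length as′ ≡ length as
    as′≡as = ℕ.≤-antisym ([ proj₁ , ℕ.≤-trans as′≤bs′ ∘ proj₁ ]′ f) ([ proj₁ , ℕ.≤-trans as≤bs ∘ proj₁ ]′ g)
    same : (length as′ ≤ length as × (length as′ ≡ length as → as′ ↭ as)) → _
    same (_ , eq) = inj₁ (mountain-determined {m = m} {bs = bs} {m′ = m′} sa sb sa′ sb′ (eq as′≡as) p)
    reversed : (length bs′ ≤ length as × (length bs′ ≡ length as → bs′ ↭ as)) → _
    reversed (bs′≤as , eq) = inj₂ (≡.trans
      (mountain-determined {m = m} {bs = bs} {m′ = m′} sa sb sb′ sa′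
        (eq (ℕ.≤-antisym bs′≤as (ℕ.≤-trans (ℕ.≤-reflexive (sym as′≡as)) as′≤bs′)))
        (↭-trans p (↭-trans (↭-sym (↭-reverse _)) (↭-reflexive (mountain-reverse as′ m′ t bs′)))))
      (sym (mountain-reverse as′ m′ t bs′)))

-- Peaks

reverse-AllPairs : ∀ {R : A → A → Set} {xs} → AllPairs R xs → AllPairs (λ x y → R y x) (reverse xs)
reverse-AllPairs []                   = []
reverse-AllPairs {xs = x ∷ xs} (px ∷ pxs) = subst (AllPairs _) (sym (List.unfold-reverse x xs))
  (AllPairs.++⁺ (reverse-AllPairs pxs) ([] ∷ []) (All.map (_∷ []) (All-reverse px)))

ascent : ∀ {t} xs → AllPairs _≤_ (xs ∷ʳ t) → ∃[ as ] ∃[ k ] xs ≡ as ++ replicate k t × Slope t as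
ascent []       _        = [] , 0 , refl , slope [] []
ascent {t} (x ∷ xs) (x≤ ∷ ↗) with ascent xs ↗
... | as , k , refl , slope ↗as as<t with ℕ.m≤n⇒m<n∨m≡n (All.head (All.++⁻ʳ (as ++ replicate k t) x≤))
...   | inj₁ x<t  = x ∷ as , k , refl , slope (All.++⁻ˡ as (All.++⁻ˡ (as ++ replicate k t) x≤) ∷ ↗as) (x<t ∷ as<t)
-- Here x = t, so all later entries are at least `t` and nothing strictly below it can follow.
...   | inj₂ refl = [] , suc k , cong (t ∷_) (cong (_++ replicate k t) (as-empty as as<t x≤)) , slope [] []
  where
  as-empty : ∀ as → All (_< t) as → All (t ≤_) ((as ++ replicate k t) ∷ʳ t) → as ≡ []
  as-empty []       _         _         = refl
  as-empty (a ∷ as) (a<t ∷ _) (t≤a ∷ _) = contradiction t≤a (ℕ.<⇒≱ a<t)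

drop-toℕ : (xs : List A) (i : Fin (length xs)) → drop (toℕ i) xs ≡ List.lookup xs i ∷ drop (suc (toℕ i)) xs
drop-toℕ (x ∷ xs) fzero    = refl
drop-toℕ (x ∷ xs) (fsuc i) = drop-toℕ xs i

split-at : (xs : List A) (i : Fin (length xs)) → xs ≡ take (toℕ i) xs ++ List.lookup xs i ∷ drop (suc (toℕ i)) xs
split-at xs i = ≡.trans (sym (List.take++drop≡id (toℕ i) xs)) (cong (take (toℕ i) xs ++_) (drop-toℕ xs i))

replicate-++ : ∀ k l {t : A} xs → replicate k t ++ t ∷ replicate l t ++ xs ≡ t ∷ replicate (k + l) t ++ xs
replicate-++ zero    l     xs = refl
replicate-++ (suc k) l {t} xs = cong (t ∷_) (replicate-++ k l xs)

-- The given peak may lie anywhere on the plateau, with `k` further copies of `t` before it and `l`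
-- after it. The descending side is treated by reversal, and the whole list is reversed if its left
-- slope is the longer one.
peak⇒ridge : ∀ cs (i : Fin (length cs)) → Linked _≤_ (take (suc (toℕ i)) cs) → Linked (λ m n → n ≤ m) (drop (toℕ i) cs) →
             Ridge cs ⊎ Ridge (reverse cs)
peak⇒ridge cs i ↗ ↘
  with as , k , pre≡ , sa ← ascent (take (toℕ i) cs)
         (subst (AllPairs _≤_) (List.take-suc cs i) (Linked.Linked⇒AllPairs ℕ.≤-trans ↗))
  with bs , l , post≡ , sb ← ascent (reverse (drop (suc (toℕ i)) cs))
         (subst (AllPairs _≤_) (≡.trans (cong reverse (drop-toℕ cs i)) (List.unfold-reverse (List.lookup cs i) (drop (suc (toℕ i)) cs)))
           (reverse-AllPairs (Linked.Linked⇒AllPairs (λ p q → ℕ.≤-trans q p) ↘)))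
  = [ (λ as≤bs → inj₁ (ridge sa sb as≤bs cs≡))
    , (λ bs≤as → inj₂ (ridge sb sa bs≤as (≡.trans (sym (mountain-reverse as (k + l) t bs)) (cong reverse cs≡)))) ]′
    (ℕ.≤-total (length as) (length bs))
  where
  open ≡-Reasoning
  t    = List.lookup cs i
  post = drop (suc (toℕ i)) cs
  cs≡ : mountain as (k + l) t bs ≡ cs
  cs≡ = begin
    as ++ t ∷ replicate (k + l) t ++ reverse bs
      ≡⟨ cong (as ++_) (replicate-++ k l (reverse bs)) ⟨
    as ++ replicate k t ++ t ∷ replicate l t ++ reverse bs
      ≡⟨ List.++-assoc as _ _ ⟨
    (as ++ replicate k t) ++ t ∷ replicate l t ++ reverse bs
      ≡⟨ cong₂ (λ xs ys → xs ++ t ∷ ys ++ reverse bs) (sym pre≡) (sym (reverse-replicate l t)) ⟩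
    take (toℕ i) cs ++ t ∷ reverse (replicate l t) ++ reverse bs
      ≡⟨ cong (λ ys → take (toℕ i) cs ++ t ∷ ys) (List.reverse-++ bs (replicate l t)) ⟨
    take (toℕ i) cs ++ t ∷ reverse (bs ++ replicate l t)
      ≡⟨ cong (λ ys → take (toℕ i) cs ++ t ∷ ys) (≡.trans (cong reverse (sym post≡)) (List.reverse-involutive post)) ⟩
    take (toℕ i) cs ++ t ∷ post
      ≡⟨ split-at cs i ⟨
    cs ∎

equal-or-reverse-reverseˡ : ∀ {as bs} → EqualOrReverse (reverse as) bs → EqualOrReverse as bs
equal-or-reverse-reverseˡ {as} (inj₁ e) = inj₂ (≡.trans (sym (List.reverse-involutive as)) (cong reverse e))
equal-or-reverse-reverseˡ      (inj₂ e) = inj₁ (List.reverse-injective e)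

equal-or-reverse-reverseʳ : ∀ {as bs} → EqualOrReverse as (reverse bs) → EqualOrReverse as bs
equal-or-reverse-reverseʳ           (inj₁ e) = inj₂ e
equal-or-reverse-reverseʳ {bs = bs} (inj₂ e) = inj₁ (≡.trans e (List.reverse-involutive bs))

⊴-reverse⁻ : ∀ as → reverse as ⊴ as
⊴-reverse⁻ as = subst (reverse as ⊴_) (List.reverse-involutive as) (⊴-reverse (reverse as))

unimodal-equal-or-reverse : ∀ {as bs} → Ridge as ⊎ Ridge (reverse as) → Ridge bs ⊎ Ridge (reverse bs) →
  All NonZero as → All NonZero bs → as ⊴ bs → bs ⊴ as → 1 < length as → EqualOrReverse as bs
unimodal-equal-or-reverse {as} {bs} (inj₁ ra) (inj₁ rb) nza nzb a⊴b b⊴a 1< =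
  ridge-equal-or-reverse ra rb nza nzb a⊴b b⊴a 1<
unimodal-equal-or-reverse {as} {bs} (inj₁ ra) (inj₂ rb) nza nzb a⊴b b⊴a 1< =
  equal-or-reverse-reverseʳ (ridge-equal-or-reverse ra rb nza (All-reverse nzb)
    (⊴-trans a⊴b (⊴-reverse bs)) (⊴-trans (⊴-reverse⁻ bs) b⊴a) 1<)
unimodal-equal-or-reverse {as} {bs} (inj₂ ra) rb nza nzb a⊴b b⊴a 1< =
  equal-or-reverse-reverseˡ (unimodal-equal-or-reverse′ rb)
  where
  1<′ = subst (1 <_) (sym (List.length-reverse as)) 1<
  a⊴b′ : reverse as ⊴ bs
  a⊴b′ = ⊴-trans (⊴-reverse⁻ as) a⊴b
  b⊴a′ : bs ⊴ reverse as
  b⊴a′ = ⊴-trans b⊴a (⊴-reverse as)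
  unimodal-equal-or-reverse′ : Ridge bs ⊎ Ridge (reverse bs) → EqualOrReverse (reverse as) bs
  unimodal-equal-or-reverse′ (inj₁ rb) = ridge-equal-or-reverse ra rb (All-reverse nza) nzb a⊴b′ b⊴a′ 1<′
  unimodal-equal-or-reverse′ (inj₂ rb) = equal-or-reverse-reverseʳ
    (ridge-equal-or-reverse ra rb (All-reverse nza) (All-reverse nzb)
      (⊴-trans a⊴b′ (⊴-reverse bs)) (⊴-trans (⊴-reverse⁻ bs) b⊴a′) 1<′)

-- Reversing a signed path

-- Adjacency in terms of natural numbers and a splitting of the sign list, which avoids casts
-- between the vertex types of a path and its reversal.
SignAt : List Sign → Sign → ℕ → ℕ → Set
SignAt s σ i j = ∃[ xs ] ∃[ ys ] s ≡ xs ++ σ ∷ ys ×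
  ((i ≡ length xs × j ≡ suc (length xs)) ⊎ (i ≡ suc (length xs) × j ≡ length xs))

adj⇒signAt : ∀ s {σ u w} → EdgeSet.Adj (pathEdges s σ) u w → SignAt s σ (toℕ u) (toℕ w)
adj⇒signAt s {σ} (k , refl , joins) = take (toℕ k) s , drop (suc (toℕ k)) s , split-at s k , Sum.map
  (λ { (refl , refl) → ≡.trans (Fin.toℕ-inject₁ k) (sym len) , cong suc (sym len) })
  (λ { (refl , refl) → cong suc (sym len) , ≡.trans (Fin.toℕ-inject₁ k) (sym len) }) joins
  where
  len : length (take (toℕ k) s) ≡ toℕ k
  len = ≡.trans (List.length-take (toℕ k) s) (ℕ.m≤n⇒m⊓n≡m (ℕ.<⇒≤ (Fin.toℕ<n k)))

signAt⇒adj : ∀ s {σ u w} → SignAt s σ (toℕ u) (toℕ w) → EdgeSet.Adj (pathEdges s σ) u w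
signAt⇒adj s {σ} {u} {w} (xs , ys , refl , joins) =
  let k , s≡ , k≡ = index xs
      at-k : ∀ {v} → toℕ v ≡ length xs → v ≡ inject₁ k
      at-k e = Fin.toℕ-injective (≡.trans e (sym (≡.trans (Fin.toℕ-inject₁ k) k≡)))
      at-suc : ∀ {v} → toℕ v ≡ suc (length xs) → v ≡ fsuc k
      at-suc e = Fin.toℕ-injective (≡.trans e (cong suc (sym k≡)))
  in k , s≡ , Sum.map (Product.map at-k at-suc) (Product.map at-suc at-k) joins
  where
  index : ∀ xs → ∃[ k ] List.lookup (xs ++ σ ∷ ys) k ≡ σ × toℕ k ≡ length xs
  index []       = fzero , refl , refl
  index (x ∷ xs) = let k , s≡ , k≡ = index xs in fsuc k , s≡ , cong suc k≡

-- The vertices are numbered from 0 to `length s`. Reflection exchanges the endpoints of each edge,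
-- hence the `Sum.swap`.
signAt-reverse : ∀ {s σ i j} → SignAt s σ i j → SignAt (reverse s) σ (length s ∸ i) (length s ∸ j)
signAt-reverse {σ = σ} (xs , ys , refl , joins) = reverse ys , reverse xs , reversed , Sum.swap (Sum.map
  (λ { (refl , refl) → at-start , at-end }) (λ { (refl , refl) → at-end , at-start }) joins)
  where
  open ≡-Reasoning
  reversed : reverse (xs ++ σ ∷ ys) ≡ reverse ys ++ σ ∷ reverse xs
  reversed = begin
    reverse (xs ++ σ ∷ ys)             ≡⟨ List.reverse-++ xs (σ ∷ ys) ⟩
    reverse (σ ∷ ys) ++ reverse xs     ≡⟨ cong (_++ reverse xs) (List.unfold-reverse σ ys) ⟩
    (reverse ys ∷ʳ σ) ++ reverse xs    ≡⟨ List.++-assoc (reverse ys) _ _ ⟩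
    reverse ys ++ σ ∷ reverse xs       ∎
  at-start : length (xs ++ σ ∷ ys) ∸ length xs ≡ suc (length (reverse ys))
  at-start = begin
    length (xs ++ σ ∷ ys) ∸ length xs              ≡⟨ cong (_∸ length xs) (List.length-++ xs) ⟩
    (length xs + suc (length ys)) ∸ length xs      ≡⟨ ℕ.m+n∸m≡n (length xs) _ ⟩
    suc (length ys)                                  ≡⟨ cong suc (List.length-reverse ys) ⟨
    suc (length (reverse ys))                        ∎
  at-end : length (xs ++ σ ∷ ys) ∸ suc (length xs) ≡ length (reverse ys)
  at-end = begin
    length (xs ++ σ ∷ ys) ∸ suc (length xs)        ≡⟨ cong (_∸ suc (length xs)) (≡.trans (List.length-++ xs) (ℕ.+-suc (length xs) _)) ⟩
    suc (length xs + length ys) ∸ suc (length xs)  ≡⟨ ℕ.m+n∸m≡n (length xs) _ ⟩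
    length ys                                        ≡⟨ List.length-reverse ys ⟨
    length (reverse ys)                              ∎

signedPath-reverse : ∀ s → signedPath s ≅ signedPath (reverse s)
signedPath-reverse s = record
  { bijection = mk↔ₛ′ to from to-from from-to
  ; positive  = adjacent pos
  ; negative  = adjacent neg
  ; loop      = λ u → mk⇔ (λ u∈⊥ → contradiction u∈⊥ ∉⊥) (λ u∈⊥ → contradiction u∈⊥ ∉⊥)
  }
  where
  n = length s
  n≡ : length (reverse s) ≡ n
  n≡ = List.length-reverse s
  to : Fin (suc n) → Fin (suc (length (reverse s)))
  to u = Fin.cast (cong suc (sym n≡)) (opposite u)
  from : Fin (suc (length (reverse s))) → Fin (suc n)
  from v = opposite (Fin.cast (cong suc n≡) v)
  toℕ-to : ∀ u → toℕ (to u) ≡ n ∸ toℕ u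
  toℕ-to u = ≡.trans (Fin.toℕ-cast _ (opposite u)) (Fin.opposite-prop u)
  toℕ-from : ∀ v → toℕ (from v) ≡ n ∸ toℕ v
  toℕ-from v = ≡.trans (Fin.opposite-prop (Fin.cast (cong suc n≡) v)) (cong (n ∸_) (Fin.toℕ-cast (cong suc n≡) v))
  to-from : ∀ v → to (from v) ≡ v
  to-from v = Fin.toℕ-injective (≡.trans (toℕ-to (from v)) (≡.trans (cong (n ∸_) (toℕ-from v))
    (ℕ.m∸[m∸n]≡n (subst (toℕ v ≤_) n≡ (Fin.toℕ≤pred[n] v)))))
  twice : ∀ u → n ∸ (n ∸ toℕ u) ≡ toℕ u
  twice u = ℕ.m∸[m∸n]≡n (Fin.toℕ≤pred[n] u)
  from-to : ∀ u → from (to u) ≡ u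
  from-to u = Fin.toℕ-injective (≡.trans (toℕ-from (to u)) (≡.trans (cong (n ∸_) (toℕ-to u)) (twice u)))
  adjacent : ∀ σ u w → EdgeSet.Adj (pathEdges s σ) u w ⇔ EdgeSet.Adj (pathEdges (reverse s) σ) (to u) (to w)
  adjacent σ u w = mk⇔
    (λ a → signAt⇒adj (reverse s) (subst₂ (SignAt (reverse s) σ) (sym (toℕ-to u)) (sym (toℕ-to w))
             (signAt-reverse (adj⇒signAt s a))))
    (λ a → signAt⇒adj s (subst₂ (SignAt s σ) (back u) (back w)
             (subst (λ r → SignAt r σ (length (reverse s) ∸ toℕ (to u)) (length (reverse s) ∸ toℕ (to w))) (List.reverse-involutive s) (signAt-reverse (adj⇒signAt (reverse s) a)))))
    where
    back : ∀ u → length (reverse s) ∸ toℕ (to u) ≡ toℕ u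
    back u = ≡.trans (cong₂ _∸_ n≡ (toℕ-to u)) (twice u)

≅-reflexive : ∀ {Γ Δ} → Γ ≡ Δ → Γ ≅ Δ
≅-reflexive refl = record
  { bijection = mk↔ₛ′ id id (λ _ → refl) (λ _ → refl)
  ; positive  = λ _ _ → mk⇔ id id
  ; negative  = λ _ _ → mk⇔ id id
  ; loop      = λ _ → mk⇔ id id
  }

-- From compositions to isomorphic signed paths

paths-isomorphic : ∀ as bs → EqualOrReverse as bs → signedPath (signs as) ≅ signedPath (signs bs)
paths-isomorphic as bs (inj₁ e) = ≅-reflexive (cong (signedPath ∘ signs) e)
paths-isomorphic as bs (inj₂ e) = subst (λ s → signedPath (signs as) ≅ signedPath s)
  (≡.trans (sym (signs-reverse as)) (cong signs (≡.trans (cong reverse e) (List.reverse-involutive bs))))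
  (signedPath-reverse (signs as))

equal-or-reverse : (α β : Composition) → Composition.partList α ⊴ Composition.partList β →
  Composition.partList β ⊴ Composition.partList α →
  (Composition.len α ≤ 4) ⊎ (Unimodal α × Unimodal β) →
  EqualOrReverse (Composition.partList α) (Composition.partList β)
equal-or-reverse α β a⊴b b⊴a cond = [ short , unimodal ]′ cond
  where
  as = Composition.partList α
  bs = Composition.partList β
  nonZero : (γ : Composition) → All NonZero (Composition.partList γ)
  nonZero γ = All⁺.toList⁺ (Composition.positive γ)
  short : length as ≤ 4 → EqualOrReverse as bs
  short = equal-or-reverse≤4 (nonZero α) (nonZero β) a⊴b b⊴a
  unimodal : Unimodal α × Unimodal β → EqualOrReverse as bs
  unimodal ((i , ↗as , ↘as) , (j , ↗bs , ↘bs)) with length as ℕ.≤? 4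
  ... | yes as≤4 = short as≤4
  -- Treating short compositions separately disposes of a single part, where nothing follows the
  -- peak; here the length is certainly above 1.
  ... | no  as≰4 = unimodal-equal-or-reverse (peak⇒ridge as i ↗as ↘as) (peak⇒ridge bs j ↗bs ↘bs)
    (nonZero α) (nonZero β) a⊴b b⊴a (ℕ.≤-trans (s≤s (s≤s z≤n)) (ℕ.≰⇒> as≰4))

theorem1p9 : (α β : Composition) → X (P α) ≐ X (P β) →
    (Composition.len α ≤ 4) ⊎ (Unimodal α × Unimodal β) →
    P α ≅ P β
theorem1p9 α β X≐ cond = paths-isomorphic as bs (equal-or-reverse α β
  (≼⇒⊴ {as = List⁺.tail (Composition.parts α)} {bs = List⁺.tail (Composition.parts β)} (X⇒≼ (signs as) (signs bs) X≐))
  (≼⇒⊴ {as = List⁺.tail (Composition.parts β)} {bs = List⁺.tail (Composition.parts α)} (X⇒≼ (signs bs) (signs as) (λ m → sym (X≐ m)))) cond)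
  where
  as = Composition.partList α
  bs = Composition.partList β
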